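{- Let $m,n,N\ge 1$ be integers. Suppose there exist $p\in(0,1)$ and nonnegative integers $c\le \frac12 m$ and $d\le\frac12 n$ for which \[ p^{\binom{m}{2}-c(c-1)}(2N)^{m-c}+(1-p)^{\binom{n}{2}-d(d-1)}(2N)^{n-d}\le\frac12 . \] Then $\tilde r(m,n)>N$.
   Context: The $(m,n)$-online Ramsey game is played by two players, Builder and Painter, on an infinite set of initially isolated vertices. Each turn, Builder places an edge between two nonadjacent vertices and Painter immediately paints it red or blue. The online Ramsey number $\tilde r(m,n)$ is the smallest number of turns $N$ within which Builder can guarantee the existence of either a red $K_m$ or a blue $K_n$, whatever Painter does. -}

module Defs where

open import Data.Empty using (⊥-elim)
open import Data.Integer.Base using (+_)
open import Data.List.Base using (List; []; _∷_; length; map; upTo)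
open import Data.List.Membership.Propositional using (_∈_)
open import Data.List.Membership.Propositional.Properties using (∈-map⁺; ∈-map⁻)
open import Data.List.Properties using (length-map; length-upTo)
open import Data.List.Relation.Binary.Sublist.Propositional
  using ([]; _∷_; _∷ʳ_; ⊆-trans; minimum) renaming (_⊆_ to _⊑_)
import Data.List.Relation.Binary.Sublist.Propositional.Properties as Sublist
open import Data.List.Relation.Unary.All as All using (All; []; _∷_)
open import Data.List.Relation.Unary.AllPairs as AllPairs using (AllPairs; []; _∷_)
open import Data.List.Relation.Unary.Any using (here; there)
open import Data.List.Relation.Unary.Unique.Propositional using (Unique)
open import Data.List.Relation.Unary.Unique.Propositional.Properties using (upTo⁺)
import Data.List.Membership.DecPropositional as DecMembership
import Data.List.Relation.Unary.All.Properties as AllP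
import Data.List.Relation.Unary.AllPairs.Properties as AllPairsP
open import Data.Nat.Base as ℕ using (ℕ; zero; suc)
import Data.Nat.Properties as ℕ
open import Data.Nat.Induction using (<-rec)
open import Data.Product.Base using (∃; _×_; _,_; proj₁; proj₂)
open import Data.Product.Properties using (≡-dec)
open import Data.Rational.Base as ℚ using (ℚ; 0ℚ; 1ℚ; ½; ∣_∣)
import Data.Rational.Properties as ℚ
open import Data.Rational.Solver using (module +-*-Solver)
open import Data.Sum.Base as Sum using (_⊎_; inj₁; inj₂; [_,_]′)
open import Function.Base using (_∘_; id)
open import Relation.Binary.Definitions using (DecidableEquality)
open import Relation.Binary.PropositionalEquality
  using (_≡_; _≢_; refl; sym; trans; cong; cong₂; subst; subst₂)
open import Relation.Nullary.Decidable using (Dec; yes; no; _×-dec_; _⊎-dec_; ¬?; map′)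
open import Relation.Nullary.Negation using (¬_)

IsCauchy : (ℕ → ℚ) → Set
IsCauchy s = ∀ ε → 0ℚ ℚ.< ε →
  ∃ λ M → ∀ i j → M ℕ.≤ i → M ℕ.≤ j → ∣ s i ℚ.- s j ∣ ℚ.< ε

-- Reals as Cauchy sequences of rationals. Different sequences can represent
-- the same real; no equality is defined because only the two order relations
-- are needed.
record ℝ : Set where
  constructor mkℝ
  field
    seq    : ℕ → ℚ
    cauchy : IsCauchy seq

open ℝ public

private abstract
  halves : ∀ ε → ε ℚ.* ½ ℚ.+ ε ℚ.* ½ ≡ ε
  halves ε = trans (sym (ℚ.*-distribˡ-+ ε ½ ½)) (ℚ.*-identityʳ ε)

  *-pos : ∀ {p q} → 0ℚ ℚ.< p → 0ℚ ℚ.< q → 0ℚ ℚ.< p ℚ.* q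
  *-pos {p} {q} 0<p 0<q =
    ℚ.positive⁻¹ (p ℚ.* q)
      {{ℚ.pos*pos⇒pos p {{ℚ.positive 0<p}} q {{ℚ.positive 0<q}}}}

  0<½ : 0ℚ ℚ.< ½
  0<½ = ℚ.positive⁻¹ ½

  eventuallyBounded : (x : ℝ) →
    ∃ λ K → 0ℚ ℚ.< K × ∃ λ M → ∀ i → M ℕ.≤ i → ∣ seq x i ∣ ℚ.≤ K
  eventuallyBounded x with cauchy x 1ℚ (ℚ.positive⁻¹ 1ℚ)
  ... | M , close = K , 0<K , M , bound
    where
    K : ℚ
    K = 1ℚ ℚ.+ ∣ seq x M ∣
    0<K : 0ℚ ℚ.< K
    0<K = ℚ.+-mono-<-≤ (ℚ.positive⁻¹ 1ℚ) (ℚ.0≤∣p∣ (seq x M))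
    split : ∀ a b → a ≡ (a ℚ.- b) ℚ.+ b
    split = solve 2 (λ a b → a := (a :- b) :+ b) refl
      where open +-*-Solver
    bound : ∀ i → M ℕ.≤ i → ∣ seq x i ∣ ℚ.≤ K
    bound i M≤i = begin
      ∣ seq x i ∣                               ≡⟨ cong ∣_∣ (split (seq x i) (seq x M)) ⟩
      ∣ (seq x i ℚ.- seq x M) ℚ.+ seq x M ∣     ≤⟨ ℚ.∣p+q∣≤∣p∣+∣q∣ (seq x i ℚ.- seq x M) (seq x M) ⟩
      ∣ seq x i ℚ.- seq x M ∣ ℚ.+ ∣ seq x M ∣   ≤⟨ ℚ.+-monoˡ-≤ ∣ seq x M ∣ (ℚ.<⇒≤ (close i M M≤i ℕ.≤-refl)) ⟩
      K                                         ∎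
      where open ℚ.≤-Reasoning

  -- If |a| ≤ K and |b| < ε/(2K) then |ab| < ε/2.
  shrink : ∀ {ε K} → 0ℚ ℚ.< ε → 0ℚ ℚ.< K →
    ∃ λ δ → 0ℚ ℚ.< δ ×
      (∀ a b → ∣ a ∣ ℚ.≤ K → ∣ b ∣ ℚ.< δ → ∣ a ℚ.* b ∣ ℚ.< ε ℚ.* ½)
  shrink {ε} {K} 0<ε 0<K = δ , *-pos (*-pos 0<ε 0<½) 0<1/K , bound
    where
    K-pos : ℚ.Positive K
    K-pos = ℚ.positive 0<K
    1/K : ℚ
    1/K = (ℚ.1/ K) {{ℚ.pos⇒nonZero K {{K-pos}}}}
    δ : ℚ
    δ = (ε ℚ.* ½) ℚ.* 1/K
    0<1/K : 0ℚ ℚ.< 1/K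
    0<1/K = ℚ.positive⁻¹ 1/K {{ℚ.1/pos⇒pos K {{K-pos}}}}
    K*δ : K ℚ.* δ ≡ ε ℚ.* ½
    K*δ = trans (ℚ.*-comm K δ)
      (trans (ℚ.*-assoc (ε ℚ.* ½) 1/K K)
        (trans (cong ((ε ℚ.* ½) ℚ.*_) (ℚ.*-inverseˡ K {{ℚ.pos⇒nonZero K {{K-pos}}}})) (ℚ.*-identityʳ _)))
    bound : ∀ a b → ∣ a ∣ ℚ.≤ K → ∣ b ∣ ℚ.< δ → ∣ a ℚ.* b ∣ ℚ.< ε ℚ.* ½
    bound a b a≤ b< = begin-strict
      ∣ a ℚ.* b ∣       ≡⟨ ℚ.∣p*q∣≡∣p∣*∣q∣ a b ⟩
      ∣ a ∣ ℚ.* ∣ b ∣   ≤⟨ ℚ.*-monoʳ-≤-nonNeg ∣ b ∣ {{ℚ.∣-∣-nonNeg b}} a≤ ⟩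
      K ℚ.* ∣ b ∣       <⟨ ℚ.*-monoʳ-<-pos K {{K-pos}} b< ⟩
      K ℚ.* δ           ≡⟨ K*δ ⟩
      ε ℚ.* ½           ∎
      where open ℚ.≤-Reasoning

private abstract
  const-cauchy : ∀ q → IsCauchy (λ _ → q)
  const-cauchy q ε 0<ε =
    0 , λ _ _ _ _ → subst (ℚ._< ε) (sym (cong ∣_∣ (ℚ.+-inverseʳ q))) 0<ε

  +-triangle : ∀ a b c d →
    ∣ (a ℚ.+ b) ℚ.- (c ℚ.+ d) ∣ ℚ.≤ ∣ a ℚ.- c ∣ ℚ.+ ∣ b ℚ.- d ∣
  +-triangle a b c d = subst (ℚ._≤ ∣ a ℚ.- c ∣ ℚ.+ ∣ b ℚ.- d ∣)
    (cong ∣_∣ (sym (rearrange a b c d))) (ℚ.∣p+q∣≤∣p∣+∣q∣ (a ℚ.- c) (b ℚ.- d))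
    where
    rearrange : ∀ a b c d → (a ℚ.+ b) ℚ.- (c ℚ.+ d) ≡ (a ℚ.- c) ℚ.+ (b ℚ.- d)
    rearrange = solve 4 (λ a b c d → (a :+ b) :- (c :+ d) := (a :- c) :+ (b :- d)) refl
      where open +-*-Solver

  *-triangle : ∀ a b c d →
    ∣ a ℚ.* b ℚ.- c ℚ.* d ∣ ℚ.≤ ∣ a ℚ.* (b ℚ.- d) ∣ ℚ.+ ∣ d ℚ.* (a ℚ.- c) ∣
  *-triangle a b c d = subst (ℚ._≤ ∣ a ℚ.* (b ℚ.- d) ∣ ℚ.+ ∣ d ℚ.* (a ℚ.- c) ∣)
    (cong ∣_∣ (sym (rearrange a b c d)))
    (ℚ.∣p+q∣≤∣p∣+∣q∣ (a ℚ.* (b ℚ.- d)) (d ℚ.* (a ℚ.- c)))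
    where
    rearrange : ∀ a b c d →
      a ℚ.* b ℚ.- c ℚ.* d ≡ a ℚ.* (b ℚ.- d) ℚ.+ d ℚ.* (a ℚ.- c)
    rearrange = solve 4 (λ a b c d →
      a :* b :- c :* d := a :* (b :- d) :+ d :* (a :- c)) refl
      where open +-*-Solver

  below-halves : ∀ {p q r} ε → p ℚ.≤ q ℚ.+ r →
    q ℚ.< ε ℚ.* ½ → r ℚ.< ε ℚ.* ½ → p ℚ.< ε
  below-halves {p} ε le q< r< =
    subst (p ℚ.<_) (halves ε) (ℚ.≤-<-trans le (ℚ.+-mono-< q< r<))

  +-cauchy : ∀ x y → IsCauchy (λ i → seq x i ℚ.+ seq y i)
  +-cauchy x y ε 0<ε =
    let 0<ε/2         = *-pos 0<ε 0<½
        M  , closeˣ = cauchy x (ε ℚ.* ½) 0<ε/2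
        M′ , closeʸ = cauchy y (ε ℚ.* ½) 0<ε/2
    in M ℕ.⊔ M′ , λ i j i≥ j≥ →
      below-halves ε (+-triangle (seq x i) (seq y i) (seq x j) (seq y j))
        (closeˣ i j (ℕ.m⊔n≤o⇒m≤o M M′ i≥) (ℕ.m⊔n≤o⇒m≤o M M′ j≥))
        (closeʸ i j (ℕ.m⊔n≤o⇒n≤o M M′ i≥) (ℕ.m⊔n≤o⇒n≤o M M′ j≥))

  neg-cauchy : ∀ x → IsCauchy (λ i → ℚ.- seq x i)
  neg-cauchy x ε 0<ε =
    let M , close = cauchy x ε 0<ε
    in M , λ i j i≥ j≥ →
      subst (ℚ._< ε)
        (trans (sym (ℚ.∣-p∣≡∣p∣ (seq x i ℚ.- seq x j)))
               (cong ∣_∣ (ℚ.neg-distrib-+ (seq x i) (ℚ.- seq x j))))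
        (close i j i≥ j≥)

  *-cauchy : ∀ x y → IsCauchy (λ i → seq x i ℚ.* seq y i)
  *-cauchy x y ε 0<ε =
    let Kˣ , 0<Kˣ , A , boundˣ = eventuallyBounded x
        Kʸ , 0<Kʸ , B , boundʸ = eventuallyBounded y
        δʸ , 0<δʸ , smallˣ     = shrink 0<ε 0<Kˣ
        δˣ , 0<δˣ , smallʸ     = shrink 0<ε 0<Kʸ
        C , closeˣ             = cauchy x δˣ 0<δˣ
        D , closeʸ             = cauchy y δʸ 0<δʸ
        AB = A ℕ.⊔ B
        CD = C ℕ.⊔ D
        ≥A = λ {i} (i≥ : AB ℕ.⊔ CD ℕ.≤ i) → ℕ.m⊔n≤o⇒m≤o A B (ℕ.m⊔n≤o⇒m≤o AB CD i≥)
        ≥B = λ {i} (i≥ : AB ℕ.⊔ CD ℕ.≤ i) → ℕ.m⊔n≤o⇒n≤o A B (ℕ.m⊔n≤o⇒m≤o AB CD i≥)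
        ≥C = λ {i} (i≥ : AB ℕ.⊔ CD ℕ.≤ i) → ℕ.m⊔n≤o⇒m≤o C D (ℕ.m⊔n≤o⇒n≤o AB CD i≥)
        ≥D = λ {i} (i≥ : AB ℕ.⊔ CD ℕ.≤ i) → ℕ.m⊔n≤o⇒n≤o C D (ℕ.m⊔n≤o⇒n≤o AB CD i≥)
    in AB ℕ.⊔ CD , λ i j i≥ j≥ →
      below-halves ε (*-triangle (seq x i) (seq y i) (seq x j) (seq y j))
        (smallˣ (seq x i) (seq y i ℚ.- seq y j) (boundˣ i (≥A i≥)) (closeʸ i j (≥D i≥) (≥D j≥)))
        (smallʸ (seq y j) (seq x i ℚ.- seq x j) (boundʸ j (≥B j≥)) (closeˣ i j (≥C i≥) (≥C j≥)))

fromℚ : ℚ → ℝ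
fromℚ q = mkℝ (λ _ → q) (const-cauchy q)

fromℕ : ℕ → ℝ
fromℕ k = fromℚ (+ k ℚ./ 1)

infixl 6 _+ℝ_ _-ℝ_
infixl 7 _*ℝ_
infixr 8 _^ℝ_
infix  4 _<ℝ_ _≤ℝ_

_+ℝ_ : ℝ → ℝ → ℝ
x +ℝ y = mkℝ (λ i → seq x i ℚ.+ seq y i) (+-cauchy x y)

-ℝ_ : ℝ → ℝ
-ℝ x = mkℝ (λ i → ℚ.- seq x i) (neg-cauchy x)

_-ℝ_ : ℝ → ℝ → ℝ
x -ℝ y = x +ℝ (-ℝ y)

_*ℝ_ : ℝ → ℝ → ℝ
x *ℝ y = mkℝ (λ i → seq x i ℚ.* seq y i) (*-cauchy x y)

_^ℝ_ : ℝ → ℕ → ℝ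
x ^ℝ zero  = fromℕ 1
x ^ℝ suc k = x *ℝ x ^ℝ k

-- Strict inequality needs a uniform gap: termwise inequality alone would
-- make (1/i) positive.
_<ℝ_ : ℝ → ℝ → Set
x <ℝ y = ∃ λ ε → 0ℚ ℚ.< ε × ∃ λ M → ∀ i → M ℕ.≤ i → seq x i ℚ.+ ε ℚ.≤ seq y i

_≤ℝ_ : ℝ → ℝ → Set
x ≤ℝ y = ∀ ε → 0ℚ ℚ.< ε → ∃ λ M → ∀ i → M ℕ.≤ i → seq x i ℚ.≤ seq y i ℚ.+ ε

data Colour : Set where
  red blue : Colour

-- The board has vertex set ℕ; a position lists the coloured edges placed
-- so far, each with an arbitrary orientation.
Position : Set
Position = List (Colour × ℕ × ℕ)

Edge : Position → Colour → ℕ → ℕ → Set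
Edge G c u v = (c , u , v) ∈ G ⊎ (c , v , u) ∈ G

Adjacent : Position → ℕ → ℕ → Set
Adjacent G u v = ∃ λ c → Edge G c u v

HasClique : Colour → ℕ → Position → Set
HasClique c k G =
  ∃ λ xs → length xs ≡ k × AllPairs (λ u v → u ≢ v × Edge G c u v) xs

-- BuilderForces m n N G: from position G, Builder can guarantee a red K_m
-- or a blue K_n within N further turns, whatever Painter does.
data BuilderForces (m n : ℕ) : ℕ → Position → Set where
  done : ∀ {N G} → HasClique red m G ⊎ HasClique blue n G → BuilderForces m n N G
  turn : ∀ {N G} u v → u ≢ v → ¬ Adjacent G u v →
         (∀ c → BuilderForces m n N ((c , u , v) ∷ G)) →
         BuilderForces m n (suc N) G

IsOnlineRamseyNumber : ℕ → ℕ → ℕ → Set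
IsOnlineRamseyNumber m n r =
  BuilderForces m n r [] × (∀ k → BuilderForces m n k [] → r ℕ.≤ k)

private
  _≟ᶜ_ : DecidableEquality Colour
  red  ≟ᶜ red  = yes refl
  red  ≟ᶜ blue = no λ ()
  blue ≟ᶜ red  = no λ ()
  blue ≟ᶜ blue = yes refl

  open DecMembership (≡-dec _≟ᶜ_ (≡-dec ℕ._≟_ ℕ._≟_)) using (_∈?_)

  Joined : Position → Colour → ℕ → ℕ → Set
  Joined G c u v = u ≢ v × Edge G c u v

  edge? : ∀ G c u v → Dec (Edge G c u v)
  edge? G c u v = ((c , u , v) ∈? G) ⊎-dec ((c , v , u) ∈? G)

  joined? : ∀ G c u v → Dec (Joined G c u v)
  joined? G c u v = ¬? (u ℕ.≟ v) ×-dec edge? G c u v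

  adjacent? : ∀ G u v → Dec (Adjacent G u v)
  adjacent? G u v = map′
    [ (red ,_) , (blue ,_) ]′
    (λ { (red , e) → inj₁ e ; (blue , e) → inj₂ e })
    (edge? G red u v ⊎-dec edge? G blue u v)

  -- Finite Ramsey theorem, for lists all of whose pairs are in R or S.

  ramseyBound : ℕ → ℕ → ℕ
  ramseyBound zero    b       = 0
  ramseyBound (suc a) zero    = 0
  ramseyBound (suc a) (suc b) = suc (ramseyBound a (suc b) ℕ.+ ramseyBound (suc a) b)

  module _ {R S : ℕ → ℕ → Set} where

    split : ∀ {v} L → All (λ x → R v x ⊎ S v x) L →
      ∃ λ X → ∃ λ Y → X ⊑ L × Y ⊑ L × All (R v) X × All (S v) Y ×
        length L ≡ length X ℕ.+ length Y
    split [] [] = [] , [] , [] , [] , [] , [] , refl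
    split (x ∷ L) (p ∷ ps) with split L ps
    split (x ∷ L) (inj₁ r ∷ ps) | X , Y , X⊑ , Y⊑ , rs , ss , eq =
      x ∷ X , Y , refl ∷ X⊑ , x ∷ʳ Y⊑ , r ∷ rs , ss , cong suc eq
    split (x ∷ L) (inj₂ s ∷ ps) | X , Y , X⊑ , Y⊑ , rs , ss , eq =
      X , x ∷ Y , x ∷ʳ X⊑ , refl ∷ Y⊑ , rs , s ∷ ss ,
      trans (cong suc eq) (sym (ℕ.+-suc (length X) (length Y)))

    pigeonhole : ∀ a b x y → a ℕ.+ b ℕ.≤ x ℕ.+ y → a ℕ.≤ x ⊎ b ℕ.≤ y
    pigeonhole a b x y le with ℕ.≤-<-connex a x
    ... | inj₁ a≤x = inj₁ a≤x
    ... | inj₂ x<a with ℕ.≤-<-connex b y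
    ...   | inj₁ b≤y = inj₂ b≤y
    ...   | inj₂ y<b = ⊥-elim (ℕ.<⇒≱ (ℕ.+-mono-< x<a y<b) le)

    restrict : ∀ {T : ℕ → ℕ → Set} {X L} → X ⊑ L → AllPairs T L → AllPairs T X
    restrict []           []       = []
    restrict (_ ∷ʳ X⊑L)   (_ ∷ ps) = restrict X⊑L ps
    restrict (refl ∷ X⊑L) (p ∷ ps) = Sublist.All-resp-⊆ X⊑L p ∷ restrict X⊑L ps

    Homogeneous : (ℕ → ℕ → Set) → ℕ → List ℕ → Set
    Homogeneous T k L = ∃ λ K → K ⊑ L × length K ≡ k × AllPairs T K

    widen : ∀ {T k X L} → X ⊑ L → Homogeneous T k X → Homogeneous T k L
    widen X⊑L (K , K⊑X , len , ps) = K , ⊆-trans K⊑X X⊑L , len , ps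

    extend : ∀ {T k v X L} → X ⊑ L → All (T v) X →
             Homogeneous T k X → Homogeneous T (suc k) (v ∷ L)
    extend {v = v} X⊑L vX (K , K⊑X , len , ps) =
      v ∷ K , refl ∷ ⊆-trans K⊑X X⊑L , cong suc len , Sublist.All-resp-⊆ K⊑X vX ∷ ps

    ramsey : ∀ a b L → ramseyBound a b ℕ.≤ length L →
      AllPairs (λ u v → R u v ⊎ S u v) L → Homogeneous R a L ⊎ Homogeneous S b L
    ramsey zero    b       L       _  _ = inj₁ ([] , minimum L , refl , [])
    ramsey (suc a) zero    L       _  _ = inj₂ ([] , minimum L , refl , [])
    ramsey (suc a) (suc b) (v ∷ L) (ℕ.s≤s le) (p ∷ ps) with split L p
    ... | X , Y , X⊑L , Y⊑L , vX , vY , eq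
      with pigeonhole (ramseyBound a (suc b)) (ramseyBound (suc a) b)
             (length X) (length Y) (subst (_ ℕ.≤_) eq le)
    ...   | inj₁ leX = Sum.map (extend X⊑L vX) (widen (v ∷ʳ X⊑L))
                         (ramsey a (suc b) X leX (restrict X⊑L ps))
    ...   | inj₂ leY = Sum.map (widen (v ∷ʳ Y⊑L)) (extend Y⊑L vY)
                         (ramsey (suc a) b Y leY (restrict Y⊑L ps))

  module _ (m n : ℕ) where

    private
      Forces = BuilderForces m n

    forces-mono : ∀ {k l G} → k ℕ.≤ l → Forces k G → Forces l G
    forces-mono le         (done d)          = done d
    forces-mono (ℕ.s≤s le) (turn u v ne na f) = turn u v ne na (forces-mono le ∘ f)

    -- Builder eventually wins by completing a large enough clique.

    Wins : Position → Set
    Wins G = ∃ λ k → Forces k G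

    _⊆ᴳ_ : Position → Position → Set
    G ⊆ᴳ G′ = ∀ {e} → e ∈ G → e ∈ G′

    JoinedAny : Position → ℕ → ℕ → Set
    JoinedAny G u v = Joined G red u v ⊎ Joined G blue u v

    joined-mono : ∀ {G G′ c u v} → G ⊆ᴳ G′ → Joined G c u v → Joined G′ c u v
    joined-mono sub (ne , e) = ne , Sum.map sub sub e

    joinedAny-mono : ∀ {G G′ u v} → G ⊆ᴳ G′ → JoinedAny G u v → JoinedAny G′ u v
    joinedAny-mono {G} {G′} sub =
      Sum.map (joined-mono {G} {G′} sub) (joined-mono {G} {G′} sub)

    joinedAny : ∀ {G u v} c → u ≢ v → Edge G c u v → JoinedAny G u v
    joinedAny red  ne e = inj₁ (ne , e)
    joinedAny blue ne e = inj₂ (ne , e)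

    join : ∀ {G} u v → u ≢ v →
      (∀ G′ → G ⊆ᴳ G′ → JoinedAny G′ u v → Wins G′) → Wins G
    join {G} u v ne k with adjacent? G u v
    ... | yes (c , e) = k G id (joinedAny c ne e)
    ... | no na = suc (proj₁ r ℕ.⊔ proj₁ b) , turn u v ne na λ
      { red  → forces-mono (ℕ.m≤m⊔n (proj₁ r) (proj₁ b)) (proj₂ r)
      ; blue → forces-mono (ℕ.m≤n⊔m (proj₁ r) (proj₁ b)) (proj₂ b) }
      where
      r = k ((red  , u , v) ∷ G) there (inj₁ (ne , inj₁ (here refl)))
      b = k ((blue , u , v) ∷ G) there (inj₂ (ne , inj₁ (here refl)))

    joinAll : ∀ {G} v L → All (v ≢_) L →
      (∀ G′ → G ⊆ᴳ G′ → All (JoinedAny G′ v) L → Wins G′) → Wins G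
    joinAll v []      []         k = k _ id []
    joinAll v (x ∷ L) (ne ∷ nes) k = join v x ne λ G₁ sub₁ j →
      joinAll v L nes λ G₂ sub₂ js →
        k G₂ (sub₂ ∘ sub₁) (joinedAny-mono {G₁} {G₂} sub₂ j ∷ js)

    complete : ∀ {G} L → Unique L →
      (∀ G′ → G ⊆ᴳ G′ → AllPairs (JoinedAny G′) L → Wins G′) → Wins G
    complete []      []         k = k _ id []
    complete (v ∷ L) (ne ∷ nes) k = joinAll v L ne λ G₁ sub₁ js →
      complete L nes λ G₂ sub₂ jss →
        k G₂ (sub₂ ∘ sub₁) (All.map (joinedAny-mono {G₁} {G₂} sub₂) js ∷ jss)

    builderWins : Wins []
    builderWins = complete (upTo B) (upTo⁺ B) λ G _ js →
      0 , done (Sum.map (λ (K , _ , len , ps) → K , len , ps)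
                        (λ (K , _ , len , ps) → K , len , ps)
        (ramsey m n (upTo B) (ℕ.≤-reflexive (sym (length-upTo B))) js))
      where B = ramseyBound m n

    -- Winning positions are invariant under relabelling of the vertices.

    module _ (f : ℕ → ℕ) (f-inj : ∀ {x y} → f x ≡ f y → x ≡ y) where

      relabelEdge : Colour × ℕ × ℕ → Colour × ℕ × ℕ
      relabelEdge (c , u , v) = c , f u , f v

      relabelEdge-inj : ∀ {e e′} → relabelEdge e ≡ relabelEdge e′ → e ≡ e′
      relabelEdge-inj {c , u , v} {c′ , u′ , v′} eq =
        cong₂ _,_ (cong proj₁ eq)
          (cong₂ _,_ (f-inj (cong (proj₁ ∘ proj₂) eq)) (f-inj (cong (proj₂ ∘ proj₂) eq)))

      relabel : Position → Position
      relabel = map relabelEdge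

      edge⁺ : ∀ {G c u v} → Edge G c u v → Edge (relabel G) c (f u) (f v)
      edge⁺ = Sum.map (∈-map⁺ relabelEdge) (∈-map⁺ relabelEdge)

      ∈⁻ : ∀ {G e} → relabelEdge e ∈ relabel G → e ∈ G
      ∈⁻ e∈ with ∈-map⁻ relabelEdge e∈
      ... | e′ , e′∈ , eq = subst (_∈ _) (sym (relabelEdge-inj eq)) e′∈

      edge⁻ : ∀ {G c u v} → Edge (relabel G) c (f u) (f v) → Edge G c u v
      edge⁻ = Sum.map ∈⁻ ∈⁻

      clique⁺ : ∀ {c k G} → HasClique c k G → HasClique c k (relabel G)
      clique⁺ (xs , len , ps) = map f xs , trans (length-map f xs) len ,
        AllPairsP.map⁺ (AllPairs.map (λ (ne , e) → ne ∘ f-inj , edge⁺ e) ps)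

      forces-relabel : ∀ {k G} → Forces k G → Forces k (relabel G)
      forces-relabel (done d) = done (Sum.map clique⁺ clique⁺ d)
      forces-relabel (turn u v ne na k) =
        turn (f u) (f v) (ne ∘ f-inj) (λ (c , e) → na (c , edge⁻ e))
          (forces-relabel ∘ k)

    pick : ∀ {P Q : Set} → ℕ → ℕ → ℕ → Dec P → Dec Q → ℕ
    pick a b x (yes _) _       = b
    pick a b x (no _)  (yes _) = a
    pick a b x (no _)  (no _)  = x

    swap : ℕ → ℕ → ℕ → ℕ
    swap a b x = pick a b x (x ℕ.≟ a) (x ℕ.≟ b)

    swap-left : ∀ a b → swap a b a ≡ b
    swap-left a b = go (a ℕ.≟ a) (a ℕ.≟ b)
      where
      go : ∀ d e → pick {a ≡ a} {a ≡ b} a b a d e ≡ b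
      go (yes _)   _ = refl
      go (no a≢a) _ = ⊥-elim (a≢a refl)

    swap-right : ∀ a b → swap a b b ≡ a
    swap-right a b = go (b ℕ.≟ a) (b ℕ.≟ b)
      where
      go : ∀ d e → pick {b ≡ a} {b ≡ b} a b b d e ≡ a
      go (yes b≡a) _        = b≡a
      go (no _)    (yes _)  = refl
      go (no _)    (no b≢b) = ⊥-elim (b≢b refl)

    swap-fixes : ∀ a b {x} → x ≢ a → x ≢ b → swap a b x ≡ x
    swap-fixes a b {x} x≢a x≢b = go (x ℕ.≟ a) (x ℕ.≟ b)
      where
      go : ∀ d e → pick {x ≡ a} {x ≡ b} a b x d e ≡ x
      go (yes x≡a) _         = ⊥-elim (x≢a x≡a)
      go (no _)    (yes x≡b) = ⊥-elim (x≢b x≡b)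
      go (no _)    (no _)    = refl

    swap-involutive : ∀ a b x → swap a b (swap a b x) ≡ x
    swap-involutive a b x = go (x ℕ.≟ a) (x ℕ.≟ b)
      where
      go : Dec (x ≡ a) → Dec (x ≡ b) → swap a b (swap a b x) ≡ x
      go (yes refl) _         = trans (cong (swap a b) (swap-left a b)) (swap-right a b)
      go (no _)    (yes refl) = trans (cong (swap a b) (swap-right a b)) (swap-left a b)
      go (no x≢a)  (no x≢b)   =
        trans (cong (swap a b) (swap-fixes a b x≢a x≢b)) (swap-fixes a b x≢a x≢b)

    swap-inj : ∀ a b {x y} → swap a b x ≡ swap a b y → x ≡ y
    swap-inj a b {x} {y} eq = trans (sym (swap-involutive a b x))
      (trans (cong (swap a b) eq) (swap-involutive a b y))

    -- A permutation fixing everything below B that sends u to at most B.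
    retract : ∀ B u → ∃ λ f → (∀ {x y} → f x ≡ f y → x ≡ y) ×
      (∀ {x} → x ℕ.< B → f x ≡ x) × f u ℕ.≤ B
    retract B u with u ℕ.<? B
    ... | yes u<B = id , id , (λ _ → refl) , ℕ.<⇒≤ u<B
    ... | no  u≮B = swap u B , swap-inj u B ,
      (λ x<B → swap-fixes u B (λ { refl → u≮B x<B }) (ℕ.<⇒≢ x<B)) ,
      ℕ.≤-reflexive (swap-left u B)

    Below : ℕ → Colour × ℕ × ℕ → Set
    Below B (_ , u , v) = u ℕ.< B × v ℕ.< B

    below-mono : ∀ {B B′ e} → B ℕ.≤ B′ → Below B e → Below B′ e
    below-mono le (p , q) = ℕ.<-≤-trans p le , ℕ.<-≤-trans q le

    bound : Position → ℕ
    bound [] = 0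
    bound ((_ , u , v) ∷ G) = suc (u ℕ.⊔ v) ℕ.⊔ bound G

    bound-correct : ∀ G → All (Below (bound G)) G
    bound-correct [] = []
    bound-correct (e@(_ , u , v) ∷ G) =
      below-mono {e = e} (ℕ.m≤m⊔n (suc (u ℕ.⊔ v)) (bound G))
        (ℕ.s≤s (ℕ.m≤m⊔n u v) , ℕ.s≤s (ℕ.m≤n⊔m u v)) ∷
      All.map (λ {e′} → below-mono {e = e′} (ℕ.m≤n⊔m (suc (u ℕ.⊔ v)) (bound G)))
        (bound-correct G)

    relabel-fixes : ∀ f (f-inj : ∀ {x y} → f x ≡ f y → x ≡ y) {B G} → (∀ {x} → x ℕ.< B → f x ≡ x) →
      All (Below B) G → relabel f f-inj G ≡ G
    relabel-fixes f f-inj fix [] = refl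
    relabel-fixes f f-inj fix ((p , q) ∷ ps) =
      cong₂ _∷_ (cong₂ _,_ refl (cong₂ _,_ (fix p) (fix q))) (relabel-fixes f f-inj fix ps)

    -- Only moves on the first bound G + 2 vertices need be considered.

    Move : ℕ → Position → ℕ → ℕ → Set
    Move k G u v = u ≢ v × ¬ Adjacent G u v ×
      Forces k ((red , u , v) ∷ G) × Forces k ((blue , u , v) ∷ G)

    move-relabel : ∀ {k G u v B} f (f-inj : ∀ {x y} → f x ≡ f y → x ≡ y) →
      (∀ {x} → x ℕ.< B → f x ≡ x) → All (Below B) G →
      Move k G u v → Move k G (f u) (f v)
    move-relabel {k} {G} {u} {v} f f-inj fix bd (ne , na , r , b) =
      ne ∘ f-inj ,
      (λ (c , e) → na (c , edge⁻ f f-inj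
        (subst (λ H → Edge H c (f u) (f v)) (sym G≡) e))) ,
      subst (λ H → Forces k ((red , f u , f v) ∷ H)) G≡ (forces-relabel f f-inj r) ,
      subst (λ H → Forces k ((blue , f u , f v) ∷ H)) G≡ (forces-relabel f f-inj b)
      where G≡ = relabel-fixes f f-inj fix bd

    move-small : ∀ {k G u v} → Move k G u v →
      ∃ λ u′ → u′ ℕ.< 2 ℕ.+ bound G × ∃ λ v′ → v′ ℕ.< 2 ℕ.+ bound G × Move k G u′ v′
    move-small {k} {G} {u} {v} mv with retract (bound G) u
    ... | f , f-inj , f-fix , fu≤ with retract (suc (bound G)) (f v)
    ...   | g , g-inj , g-fix , gfv≤ =
      g (f u) , ℕ.s≤s (subst (ℕ._≤ suc (bound G)) (sym (g-fix (ℕ.s≤s fu≤))) (ℕ.m≤n⇒m≤1+n fu≤)) ,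
      g (f v) , ℕ.s≤s gfv≤ ,
      move-relabel g g-inj (g-fix ∘ ℕ.m<n⇒m<1+n) bd (move-relabel f f-inj f-fix bd mv)
      where bd = bound-correct G

    Extension : Colour → ℕ → Position → List ℕ → Set
    Extension c k G K = ∃ λ xs → length xs ≡ k × All (ℕ._< bound G) xs ×
      AllPairs (Joined G c) xs × All (λ x → All (λ y → Joined G c y x) K) xs

    extension? : ∀ c k G K → Dec (Extension c k G K)
    extension? c zero    G K = yes ([] , refl , [] , [] , [])
    extension? c (suc k) G K = map′ to from
      (ℕ.anyUpTo? (λ x → All.all? (λ y → joined? G c y x) K ×-dec extension? c k G (x ∷ K))
        (bound G))
      where
      to : _ → Extension c (suc k) G K
      to (x , x< , xK , xs , len , xs< , ps , xsK) =
        x ∷ xs , cong suc len , x< ∷ xs< , All.map All.head xsK ∷ ps ,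
        xK ∷ All.map All.tail xsK
      from : Extension c (suc k) G K → _
      from (x ∷ xs , len , x< ∷ xs< , p ∷ ps , xK ∷ xsK) =
        x , x< , xK , xs , ℕ.suc-injective len , xs< , ps , All.zipWith (λ (a , b) → a ∷ b) (p , xsK)

    joined-below : ∀ {G c u v} → Joined G c u v → u ℕ.< bound G × v ℕ.< bound G
    joined-below {G} (_ , inj₁ e) = All.lookup (bound-correct G) e
    joined-below {G} (_ , inj₂ e) with All.lookup (bound-correct G) e
    ... | p , q = q , p

    clique? : ∀ c k G → Dec (HasClique c k G)
    clique? c 0 G = yes ([] , refl , [])
    clique? c 1 G = yes (0 ∷ [] , refl , [] ∷ [])
    clique? c k@(suc (suc _)) G = map′
      (λ (xs , len , _ , ps , _) → xs , len , ps)
      (λ { (x ∷ y ∷ xs , len , p@(pxy ∷ _) ∷ ps) →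
           x ∷ y ∷ xs , len ,
           proj₁ (joined-below {G} pxy) ∷ All.map (λ j → proj₂ (joined-below {G} j)) p ,
           p ∷ ps , All.universal (λ _ → []) _ })
      (extension? c k G [])

    won? : ∀ G → Dec (HasClique red m G ⊎ HasClique blue n G)
    won? G = clique? red m G ⊎-dec clique? blue n G

    forces? : ∀ k G → Dec (Forces k G)
    forces? zero G = map′ done (λ { (done d) → d }) (won? G)
    forces? (suc k) G = map′ to from
      (won? G ⊎-dec ℕ.anyUpTo? (λ u → ℕ.anyUpTo? (λ v → move? u v) B) B)
      where
      B = 2 ℕ.+ bound G
      move? : ∀ u v → Dec (Move k G u v)
      move? u v = ¬? (u ℕ.≟ v) ×-dec ¬? (adjacent? G u v) ×-dec
        forces? k ((red , u , v) ∷ G) ×-dec forces? k ((blue , u , v) ∷ G)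
      to : _ → Forces (suc k) G
      to (inj₁ d) = done d
      to (inj₂ (u , _ , v , _ , ne , na , r , b)) =
        turn u v ne na λ { red → r ; blue → b }
      from : Forces (suc k) G → _
      from (done d)           = inj₁ d
      from (turn u v ne na f) = inj₂ (move-small (ne , na , f red , f blue))

  least : {P : ℕ → Set} → (∀ k → Dec (P k)) → ∀ k → P k →
    ∃ λ r → P r × (∀ j → P j → r ℕ.≤ j)
  least {P} P? = <-rec _ λ k rec Pk → step k rec Pk (ℕ.anyUpTo? P? k)
    where
    step : ∀ k → (∀ {j} → j ℕ.< k → P j → _) → P k → Dec (∃ λ j → j ℕ.< k × P j) → _
    step k rec Pk (yes (j , j<k , Pj)) = rec j<k Pj
    step k rec Pk (no none) = k , Pk , λ j Pj → ℕ.≮⇒≥ λ j<k → none (j , j<k , Pj)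

-- The minimum exists constructively: Builder eventually wins by Ramsey's
-- theorem, and BuilderForces is decidable because, up to relabelling the
-- vertices, each position admits finitely many moves.
abstract
  onlineRamseyNumber-exists : ∀ m n → ∃ (IsOnlineRamseyNumber m n)
  onlineRamseyNumber-exists m n =
    least (λ k → forces? m n k []) (proj₁ (builderWins m n)) (proj₂ (builderWins m n))

r̃ : ℕ → ℕ → ℕ
r̃ m n = proj₁ (onlineRamseyNumber-exists m n)

r̃-isOnlineRamseyNumber : ∀ m n → IsOnlineRamseyNumber m n (r̃ m n)
r̃-isOnlineRamseyNumber m n = proj₂ (onlineRamseyNumber-exists m n)

{-# OPTIONS --safe #-}

-- Let Painter colour each edge red with probability p. A red clique K of size
-- m is charged to a c-matching in K, given by the turns of its edges, and to the
-- remaining m − 2c vertices, each given by one end of its first edge: at most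
-- (2N)^(m−c) choices. An edge inside K is counted if, when it is played, both
-- its ends are already determined by the choice; each counted edge costs a
-- factor p. If the matching minimises Σ 2^turn, then swapping partners shows
-- that a matching edge ab precedes aw and bw for each remaining vertex w, and
-- that for matching edges ab and cd at least two of ac, ad, bc, bd come after
-- both. So at most c(c−1) edges of K are not counted. The expected number of
-- choices, all of whose counted edges are red, together with its blue analogue,
-- is a potential that Painter can keep from growing; it is at least 1 once
-- Builder has won. It starts below 1 even for a rational approximation of p,
-- since the hypothesis bounds it by 1/2.

module Submission where

open import Defs
import Algebra.Definitions.RawSemiring as RawSemiring
open import Data.Empty using (⊥; ⊥-elim)
open import Data.Integer.Base as ℤ using () renaming (+_ to pos)
import Data.Integer.Properties as ℤ
open import Data.List.Base
  using (List; []; _∷_; length; map; filter; _++_; upTo; cartesianProductWith; cartesianProduct)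
open import Data.List.Membership.Propositional using (_∈_; lose; find)
open import Data.List.Membership.Propositional.Properties
  using (∈-map⁺; ∈-++⁺ˡ; ∈-++⁺ʳ; ∈-∃++; ∈-upTo⁺; ∈-cartesianProduct⁺; ∈-cartesianProductWith⁺)
open import Data.List.Properties
  using (length-++; length-map; length-upTo; filter-all; filter-accept; filter-reject)
open import Data.List.Relation.Binary.Permutation.Propositional as ↭
  using (_↭_; refl; ↭-sym; ↭⇒↭ₛ)
import Data.List.Relation.Binary.Permutation.Propositional.Properties as ↭
import Data.List.Relation.Binary.Permutation.Setoid.Properties as Permutation
open import Data.List.Relation.Unary.All as All using (All; []; _∷_)
import Data.List.Relation.Unary.All.Properties as All
open import Data.List.Relation.Unary.AllPairs as AllPairs using (AllPairs; []; _∷_)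
import Data.List.Relation.Unary.AllPairs.Properties as AllPairs
open import Data.List.Relation.Unary.Any as Any using (Any; here; there)
import Data.List.Relation.Unary.Any.Properties as Any
open import Data.List.Relation.Unary.Unique.Propositional using (Unique)
import Data.List.Relation.Unary.Unique.Propositional.Properties as Unique
open import Data.Maybe.Base as Maybe using (Maybe; just; nothing; maybe)
open import Data.Nat using (ℕ; _≤_; _<_; _*_; _∸_)
open import Data.Nat.Base as ℕ using (zero; suc; _+_; _⊔_; s≤s; z≤n)
open import Data.Nat.Combinatorics using (_C_; nC1≡n; nCk+nC[k+1]≡[n+1]C[k+1])
open import Data.Nat.Induction using (<-rec)
open import Data.Nat.ListAction using (sum)
open import Data.Nat.ListAction.Properties using (sum-↭)
import Data.Nat.Properties as ℕ
import Data.Nat.Solver as ℕSolver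
open import Data.Product using (_×_; ∃-syntax)
open import Data.Product.Base as Product using (_,_; proj₁; proj₂; ∃)
open import Data.Rational using (½)
open import Data.Rational.Base as ℚ using (ℚ; 0ℚ; 1ℚ)
import Data.Rational.Properties as ℚ
import Data.Rational.Solver as ℚSolver
import Data.Rational.Unnormalised.Base as ℚᵘ
import Data.Rational.Unnormalised.Properties as ℚᵘ
open import Data.Sum.Base as Sum using (_⊎_; inj₁; inj₂; [_,_]′)
open import Data.Unit.Base using (⊤; tt)
open import Function.Base using (_∘_; const; id)
open import Relation.Binary.Definitions using (DecidableEquality)
open import Relation.Binary.PropositionalEquality
  using (_≡_; _≢_; refl; sym; trans; cong; cong₂; subst; subst₂; setoid; module ≡-Reasoning)
open import Relation.Nullary.Decidable
  using (Dec; yes; no; _×-dec_; _⊎-dec_; ¬?; decidable-stable; from-yes)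
open import Relation.Nullary.Negation using (¬_)
open RawSemiring ℚ.+-*-rawSemiring using (_^_)

-- Naturals embedded in the rationals, and order facts.

ι : ℕ → ℚ
ι k = pos k ℚ./ 1

toℚᵘ-ι : ∀ k → ℚ.toℚᵘ (ι k) ℚᵘ.≃ ℚᵘ.mkℚᵘ (pos k) 0
toℚᵘ-ι k = ℚ.toℚᵘ-fromℚᵘ (ℚᵘ.mkℚᵘ (pos k) 0)

ι-+ : ∀ a b → ι (a ℕ.+ b) ≡ ι a ℚ.+ ι b
ι-+ a b = ℚ.toℚᵘ-injective (begin
  ℚ.toℚᵘ (ι (a ℕ.+ b))                      ≈⟨ toℚᵘ-ι (a ℕ.+ b) ⟩
  ℚᵘ.mkℚᵘ (pos (a ℕ.+ b)) 0                 ≈⟨ ℚᵘ.*≡* (cong (ℤ._* pos 1)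
    (cong₂ ℤ._+_ (sym (ℤ.*-identityʳ (pos a))) (sym (ℤ.*-identityʳ (pos b))))) ⟩
  ℚᵘ.mkℚᵘ (pos a) 0 ℚᵘ.+ ℚᵘ.mkℚᵘ (pos b) 0  ≈⟨ ℚᵘ.+-cong (toℚᵘ-ι a) (toℚᵘ-ι b) ⟨
  ℚ.toℚᵘ (ι a) ℚᵘ.+ ℚ.toℚᵘ (ι b)            ≈⟨ ℚ.toℚᵘ-homo-+ (ι a) (ι b) ⟨
  ℚ.toℚᵘ (ι a ℚ.+ ι b)                      ∎)
  where open import Relation.Binary.Reasoning.Setoid ℚᵘ.≃-setoid

ι-* : ∀ a b → ι (a ℕ.* b) ≡ ι a ℚ.* ι b
ι-* a b = ℚ.toℚᵘ-injective (begin
  ℚ.toℚᵘ (ι (a ℕ.* b))                      ≈⟨ toℚᵘ-ι (a ℕ.* b) ⟩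
  ℚᵘ.mkℚᵘ (pos (a ℕ.* b)) 0                 ≈⟨ ℚᵘ.*≡* (cong (ℤ._* pos 1) (ℤ.pos-* a b)) ⟩
  ℚᵘ.mkℚᵘ (pos a) 0 ℚᵘ.* ℚᵘ.mkℚᵘ (pos b) 0  ≈⟨ ℚᵘ.*-cong (toℚᵘ-ι a) (toℚᵘ-ι b) ⟨
  ℚ.toℚᵘ (ι a) ℚᵘ.* ℚ.toℚᵘ (ι b)            ≈⟨ ℚ.toℚᵘ-homo-* (ι a) (ι b) ⟨
  ℚ.toℚᵘ (ι a ℚ.* ι b)                      ∎)
  where open import Relation.Binary.Reasoning.Setoid ℚᵘ.≃-setoid

ι-^ : ∀ a k → ι (a ℕ.^ k) ≡ ι a ^ k
ι-^ a zero    = refl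
ι-^ a (suc k) = trans (ι-* a (a ℕ.^ k)) (cong (ι a ℚ.*_) (ι-^ a k))

0≤ι : ∀ k → 0ℚ ℚ.≤ ι k
0≤ι k = ℚ.nonNegative⁻¹ (ι k) {{ℚ.normalize-nonNeg k 1}}

ι-mono-≤ : ∀ {a b} → a ℕ.≤ b → ι a ℚ.≤ ι b
ι-mono-≤ {a} {b} a≤b = begin
  ι a                    ≡⟨ ℚ.+-identityʳ (ι a) ⟨
  ι a ℚ.+ 0ℚ             ≤⟨ ℚ.+-monoʳ-≤ (ι a) (0≤ι (b ∸ a)) ⟩
  ι a ℚ.+ ι (b ∸ a)      ≡⟨ ι-+ a (b ∸ a) ⟨
  ι (a ℕ.+ (b ∸ a))      ≡⟨ cong ι (ℕ.m+[n∸m]≡n a≤b) ⟩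
  ι b                    ∎
  where open ℚ.≤-Reasoning

*-nonNeg : ∀ {p q} → 0ℚ ℚ.≤ p → 0ℚ ℚ.≤ q → 0ℚ ℚ.≤ p ℚ.* q
*-nonNeg {p} {q} 0≤p 0≤q = ℚ.nonNegative⁻¹ (p ℚ.* q)
  {{ℚ.nonNeg*nonNeg⇒nonNeg p {{ℚ.nonNegative 0≤p}} q {{ℚ.nonNegative 0≤q}}}}

*-monoˡ : ∀ {r p q} → 0ℚ ℚ.≤ r → p ℚ.≤ q → r ℚ.* p ℚ.≤ r ℚ.* q
*-monoˡ {r} 0≤r = ℚ.*-monoˡ-≤-nonNeg r {{ℚ.nonNegative 0≤r}}

^-nonNeg : ∀ {p} → 0ℚ ℚ.≤ p → ∀ k → 0ℚ ℚ.≤ p ^ k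
^-nonNeg 0≤p zero    = 0≤ι 1
^-nonNeg 0≤p (suc k) = *-nonNeg 0≤p (^-nonNeg 0≤p k)

-- Finite sums of rationals.

∑ : {A : Set} → List A → (A → ℚ) → ℚ
∑ []      f = 0ℚ
∑ (x ∷ L) f = f x ℚ.+ ∑ L f

module _ {A : Set} where

  ∑-const : ∀ (L : List A) r → ∑ L (λ _ → r) ≡ ι (length L) ℚ.* r
  ∑-const []      r = sym (ℚ.*-zeroˡ r)
  ∑-const (x ∷ L) r = begin
    r ℚ.+ ∑ L (λ _ → r)              ≡⟨ cong₂ ℚ._+_ (sym (ℚ.*-identityˡ r)) (∑-const L r) ⟩
    1ℚ ℚ.* r ℚ.+ ι (length L) ℚ.* r  ≡⟨ ℚ.*-distribʳ-+ r 1ℚ (ι (length L)) ⟨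
    (1ℚ ℚ.+ ι (length L)) ℚ.* r      ≡⟨ cong (ℚ._* r) (ι-+ 1 (length L)) ⟨
    ι (suc (length L)) ℚ.* r         ∎
    where open ≡-Reasoning

  ∑-nonNeg : ∀ (L : List A) {f} → (∀ x → 0ℚ ℚ.≤ f x) → 0ℚ ℚ.≤ ∑ L f
  ∑-nonNeg []      0≤f = ℚ.≤-refl
  ∑-nonNeg (x ∷ L) 0≤f = ℚ.+-mono-≤ (0≤f x) (∑-nonNeg L 0≤f)

  term≤∑ : ∀ {L : List A} {f} → (∀ x → 0ℚ ℚ.≤ f x) → ∀ {x} → x ∈ L → f x ℚ.≤ ∑ L f
  term≤∑ {y ∷ L} {f} 0≤f (here refl) = begin
    f y              ≡⟨ ℚ.+-identityʳ (f y) ⟨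
    f y ℚ.+ 0ℚ       ≤⟨ ℚ.+-monoʳ-≤ (f y) (∑-nonNeg L 0≤f) ⟩
    f y ℚ.+ ∑ L f    ∎
    where open ℚ.≤-Reasoning
  term≤∑ {y ∷ L} {f} 0≤f {x} (there x∈) = begin
    f x              ≡⟨ ℚ.+-identityˡ (f x) ⟨
    0ℚ ℚ.+ f x       ≤⟨ ℚ.+-mono-≤ (0≤f y) (term≤∑ 0≤f x∈) ⟩
    f y ℚ.+ ∑ L f    ∎
    where open ℚ.≤-Reasoning

  ∑-combine : ∀ (L : List A) {f g h} r s →
    (∀ x → r ℚ.* f x ℚ.+ s ℚ.* g x ℚ.≤ h x) →
    r ℚ.* ∑ L f ℚ.+ s ℚ.* ∑ L g ℚ.≤ ∑ L h
  ∑-combine []      r s le = ℚ.≤-reflexive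
    (trans (cong₂ ℚ._+_ (ℚ.*-zeroʳ r) (ℚ.*-zeroʳ s)) (ℚ.+-identityʳ 0ℚ))
  ∑-combine (x ∷ L) {f} {g} {h} r s le = begin
    r ℚ.* (f x ℚ.+ ∑ L f) ℚ.+ s ℚ.* (g x ℚ.+ ∑ L g)
      ≡⟨ rearrange r s (f x) (∑ L f) (g x) (∑ L g) ⟩
    (r ℚ.* f x ℚ.+ s ℚ.* g x) ℚ.+ (r ℚ.* ∑ L f ℚ.+ s ℚ.* ∑ L g)
      ≤⟨ ℚ.+-mono-≤ (le x) (∑-combine L r s le) ⟩
    h x ℚ.+ ∑ L h ∎
    where
    open ℚ.≤-Reasoning
    rearrange : ∀ r s a b c d → r ℚ.* (a ℚ.+ b) ℚ.+ s ℚ.* (c ℚ.+ d) ≡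
      (r ℚ.* a ℚ.+ s ℚ.* c) ℚ.+ (r ℚ.* b ℚ.+ s ℚ.* d)
    rearrange = solve 6 (λ r s a b c d → r :* (a :+ b) :+ s :* (c :+ d) :=
      (r :* a :+ s :* c) :+ (r :* b :+ s :* d)) refl
      where open ℚSolver.+-*-Solver

-- Weights of specifications under a random colouring.

-- A specification counts down the edges of the target colour that it still
-- needs, and dies (nothing) when an edge it counts gets the other colour.
update : {A B : Set} → Dec A → Dec B → Maybe ℕ → Maybe ℕ
update (no _)  _       s = s
update (yes _) (yes _) s = Maybe.map ℕ.pred s
update (yes _) (no _)  s = nothing

weight : ℚ → Maybe ℕ → ℚ
weight r = maybe (r ^_) 0ℚ

weight-nonNeg : ∀ {r} → 0ℚ ℚ.≤ r → ∀ s → 0ℚ ℚ.≤ weight r s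
weight-nonNeg 0≤r (just k) = ^-nonNeg 0≤r k
weight-nonNeg 0≤r nothing  = ℚ.≤-refl

-- This is the expectation over one colouring step. An uncounted edge keeps the weight, and
-- `r + s ≡ 1`. A counted edge lowers the exponent by one with probability `r` and otherwise leaves
-- weight 0.
weight-update : ∀ {A B M : Set} {r s} → r ℚ.+ s ≡ 1ℚ → 0ℚ ℚ.≤ s →
  (a : Dec A) (hit : B) (miss : M → ⊥) → ∀ k →
  r ℚ.* weight r (update a (yes hit) k) ℚ.+ s ℚ.* weight r (update a (no miss) k)
    ℚ.≤ weight r k
weight-update {r = r} {s} r+s 0≤s (no _) _ _ k = ℚ.≤-reflexive (begin
  r ℚ.* weight r k ℚ.+ s ℚ.* weight r k ≡⟨ ℚ.*-distribʳ-+ (weight r k) r s ⟨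
  (r ℚ.+ s) ℚ.* weight r k              ≡⟨ cong (ℚ._* weight r k) r+s ⟩
  1ℚ ℚ.* weight r k                     ≡⟨ ℚ.*-identityˡ (weight r k) ⟩
  weight r k                            ∎)
  where open ≡-Reasoning
weight-update {r = r} {s} r+s 0≤s (yes _) _ _ k =
  subst (ℚ._≤ weight r k)
    (sym (trans (cong (r ℚ.* weight r (Maybe.map ℕ.pred k) ℚ.+_) (ℚ.*-zeroʳ s))
      (ℚ.+-identityʳ _)))
    (hits k)
  where
  hits : ∀ k → r ℚ.* weight r (Maybe.map ℕ.pred k) ℚ.≤ weight r k
  hits nothing        = ℚ.≤-reflexive (ℚ.*-zeroʳ r)
  hits (just (suc k)) = ℚ.≤-refl
  -- The only case that loses weight: `pred` keeps the counter at 0, so a factor `r ≤ 1` is given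
  -- away.
  hits (just zero)    = begin
    r ℚ.* 1ℚ   ≡⟨ ℚ.*-identityʳ r ⟩
    r          ≡⟨ ℚ.+-identityʳ r ⟨
    r ℚ.+ 0ℚ   ≤⟨ ℚ.+-monoʳ-≤ r 0≤s ⟩
    r ℚ.+ s    ≡⟨ r+s ⟩
    1ℚ         ∎
    where open ℚ.≤-Reasoning

_≟ᶜ_ : DecidableEquality Colour
red  ≟ᶜ red  = yes refl
red  ≟ᶜ blue = no λ ()
blue ≟ᶜ red  = no λ ()
blue ≟ᶜ blue = yes refl

-- Marks, known vertices and the potential.

data Side : Set where
  left right both : Side

-- A mark (t , s) names the endpoints on side s of the edge played at turn t;
-- turns count from 0, so that edge sits above t older ones in a position.
Mark : Set
Mark = ℕ × Side

End : Side → ℕ → ℕ → ℕ → Set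
End left  u v x = x ≡ u
End right u v x = x ≡ v
End both  u v x = x ≡ u ⊎ x ≡ v

end? : ∀ s u v x → Dec (End s u v x)
end? left  u v x = x ℕ.≟ u
end? right u v x = x ℕ.≟ v
end? both  u v x = (x ℕ.≟ u) ⊎-dec (x ℕ.≟ v)

Reveals : Position → Mark → ℕ → Set
Reveals []                _       x = ⊥
Reveals ((_ , u , v) ∷ G) (t , s) x =
  (t ≡ length G × End s u v x) ⊎ Reveals G (t , s) x

reveals? : ∀ G μ x → Dec (Reveals G μ x)
reveals? []                _       x = no λ ()
reveals? ((_ , u , v) ∷ G) (t , s) x =
  ((t ℕ.≟ length G) ×-dec end? s u v x) ⊎-dec reveals? G (t , s) x

Known : List Mark → Position → ℕ → Set
Known σ G x = Any (λ μ → Reveals G μ x) σ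

known? : ∀ σ G x → Dec (Known σ G x)
known? σ G x = Any.any? (λ μ → reveals? G μ x) σ

-- The colour put on u v is irrelevant here: it is fixed only so that a
-- position can be formed.
Counted : List Mark → Position → ℕ → ℕ → Set
Counted σ G u v = Known σ ((red , u , v) ∷ G) u × Known σ ((red , u , v) ∷ G) v

counted? : ∀ σ G u v → Dec (Counted σ G u v)
counted? σ G u v =
  known? σ ((red , u , v) ∷ G) u ×-dec known? σ ((red , u , v) ∷ G) v

-- `E` is the quota of edges still required at the start. The head of a position is its newest edge,
-- so the recursion processes edges in playing order.
status : Colour → ℕ → List Mark → Position → Maybe ℕ
status c E σ []                 = just E
status c E σ ((c′ , u , v) ∷ G) =
  update (counted? σ G u v) (c ≟ᶜ c′) (status c E σ G)

potential : Colour → ℚ → ℕ → List (List Mark) → Position → ℚ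
potential c r E S G = ∑ S (λ σ → weight r (status c E σ G))

-- Whether the new edge is counted does not depend on its colour, so both outcomes share one
-- decision and `weight-update` applies to each specification.
potential-step : ∀ {c c′ r s} → c ≢ c′ → r ℚ.+ s ≡ 1ℚ → 0ℚ ℚ.≤ s → ∀ E S G u v →
  r ℚ.* potential c r E S ((c , u , v) ∷ G) ℚ.+ s ℚ.* potential c r E S ((c′ , u , v) ∷ G)
    ℚ.≤ potential c r E S G
potential-step {c} {c′} {r} {s} c≢c′ r+s 0≤s E S G u v = ∑-combine S r s step
  where
  step : ∀ σ → r ℚ.* weight r (status c E σ ((c , u , v) ∷ G))
    ℚ.+ s ℚ.* weight r (status c E σ ((c′ , u , v) ∷ G)) ℚ.≤ weight r (status c E σ G)
  step σ with c ≟ᶜ c | c ≟ᶜ c′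
  ... | no c≢c | _        = ⊥-elim (c≢c refl)
  ... | yes _  | yes c≡c′ = ⊥-elim (c≢c′ c≡c′)
  ... | yes c≡c | no miss =
    weight-update r+s 0≤s (counted? σ G u v) c≡c miss (status c E σ G)

hits : List Mark → Position → ℕ
hits σ []                = 0
hits σ ((_ , u , v) ∷ G) with counted? σ G u v
... | yes _ = suc (hits σ G)
... | no _  = hits σ G

-- `K` will be the clique. A counted edge has both ends known, hence in `K`, hence has the target
-- colour; so the specification never dies.
status-alive : ∀ {c E σ} (K : ℕ → Set) G → (∀ {x} → Known σ G x → K x) →
  (∀ {c′ u v} → (c′ , u , v) ∈ G → K u → K v → c ≡ c′) →
  status c E σ G ≡ just (E ∸ hits σ G)
status-alive K [] known mono = refl
status-alive {c} {E} {σ} K ((c′ , u , v) ∷ G) known mono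
  with counted? σ G u v | c ≟ᶜ c′
     | status-alive {c} {E} {σ} K G (known ∘ Any.map inj₂) (mono ∘ there)
... | no _         | _      | ih = ih
-- `ku` and `kv` speak of a red edge, but `Reveals` ignores colours, so they serve for `c′` as well.
... | yes (ku , kv) | no c≢c′ | ih = ⊥-elim (c≢c′ (mono (here refl) (known ku) (known kv)))
... | yes _        | yes _  | ih = trans (cong (Maybe.map ℕ.pred) ih)
  (cong just (ℕ.pred[m∸n]≡m∸[1+n] E (hits σ G)))

-- Turns at which edges are played, and first edges.

Joins : ℕ → ℕ → ℕ → ℕ → Set
Joins u v x y = (u ≡ x × v ≡ y) ⊎ (u ≡ y × v ≡ x)

joins? : ∀ u v x y → Dec (Joins u v x y)
joins? u v x y = ((u ℕ.≟ x) ×-dec (v ℕ.≟ y)) ⊎-dec ((u ℕ.≟ y) ×-dec (v ℕ.≟ x))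

joins-trans : ∀ {u v x y x′ y′} → Joins u v x y → Joins u v x′ y′ → Joins x y x′ y′
joins-trans (inj₁ (refl , refl)) j = j
joins-trans (inj₂ (refl , refl)) j = Sum.swap (Sum.map Product.swap Product.swap j)

JoinedAt : Position → ℕ → ℕ → ℕ → Set
JoinedAt []                t x y = ⊥
JoinedAt ((_ , u , v) ∷ G) t x y = (t ≡ length G × Joins u v x y) ⊎ JoinedAt G t x y

joinedAt-sym : ∀ G {t x y} → JoinedAt G t x y → JoinedAt G t y x
joinedAt-sym (_ ∷ G) = Sum.map (Product.map₂ Sum.swap) (joinedAt-sym G)

joinedAt-< : ∀ G {t x y} → JoinedAt G t x y → t < length G
joinedAt-< (_ ∷ G) (inj₁ (refl , _)) = ℕ.≤-refl
joinedAt-< (_ ∷ G) (inj₂ j)          = ℕ.m<n⇒m<1+n (joinedAt-< G j)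

joinedAt-unique : ∀ G {t x y x′ y′} → JoinedAt G t x y → JoinedAt G t x′ y′ → Joins x y x′ y′
joinedAt-unique (_ ∷ G) (inj₁ (_ , j))    (inj₁ (_ , j′))   = joins-trans j j′
joinedAt-unique (_ ∷ G) (inj₁ (refl , _)) (inj₂ j′)         = ⊥-elim (ℕ.<-irrefl refl (joinedAt-< G j′))
joinedAt-unique (_ ∷ G) (inj₂ j)          (inj₁ (refl , _)) = ⊥-elim (ℕ.<-irrefl refl (joinedAt-< G j))
joinedAt-unique (_ ∷ G) (inj₂ j)          (inj₂ j′)         = joinedAt-unique G j j′

reveals-< : ∀ G {t s x} → Reveals G (t , s) x → t < length G
reveals-< (_ ∷ G) (inj₁ (refl , _)) = ℕ.≤-refl
reveals-< (_ ∷ G) (inj₂ r)          = ℕ.m<n⇒m<1+n (reveals-< G r)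

-- The value 0 for nonadjacent pairs is a dummy; the matching argument evaluates turns inside a
-- clique.
turnOf : Position → ℕ → ℕ → ℕ
turnOf []                x y = 0
turnOf ((_ , u , v) ∷ G) x y with joins? u v x y
... | yes _ = length G
... | no _  = turnOf G x y

turnOf-joined : ∀ G {x y} → Adjacent G x y → JoinedAt G (turnOf G x y) x y
turnOf-joined [] (c , inj₁ ())
turnOf-joined [] (c , inj₂ ())
turnOf-joined ((_ , u , v) ∷ G) {x} {y} (c , e) with joins? u v x y
... | yes j = inj₁ (refl , j)
... | no ¬j = inj₂ (turnOf-joined G (c , older e))
  where
  older : _ → Edge G c x y
  older (inj₁ (here refl)) = ⊥-elim (¬j (inj₁ (refl , refl)))
  older (inj₁ (there e))   = inj₁ e
  older (inj₂ (here refl)) = ⊥-elim (¬j (inj₂ (refl , refl)))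
  older (inj₂ (there e))   = inj₂ e

reveals-both : ∀ G {t a b} → JoinedAt G t a b →
  Reveals G (t , both) a × Reveals G (t , both) b ×
  (∀ {x} → Reveals G (t , both) x → x ≡ a ⊎ x ≡ b)
reveals-both (_ ∷ G) (inj₁ (refl , inj₁ (refl , refl))) =
  inj₁ (refl , inj₁ refl) , inj₁ (refl , inj₂ refl) ,
  λ { (inj₁ (_ , e)) → e ; (inj₂ r) → ⊥-elim (ℕ.<-irrefl refl (reveals-< G r)) }
reveals-both (_ ∷ G) (inj₁ (refl , inj₂ (refl , refl))) =
  inj₁ (refl , inj₂ refl) , inj₁ (refl , inj₁ refl) ,
  λ { (inj₁ (_ , e)) → Sum.swap e ; (inj₂ r) → ⊥-elim (ℕ.<-irrefl refl (reveals-< G r)) }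
reveals-both (_ ∷ G) (inj₂ j) with reveals-both G j
... | ra , rb , only = inj₂ ra , inj₂ rb ,
  λ { (inj₁ (refl , _)) → ⊥-elim (ℕ.<-irrefl refl (joinedAt-< G j)) ; (inj₂ r) → only r }

-- Such a mark makes `w` known no later than any edge at `w` is played, and makes no other vertex
-- known.
record IsFirst (G : Position) (w : ℕ) (μ : Mark) : Set where
  field
    reveals  : Reveals G μ w
    only     : ∀ {x} → Reveals G μ x → x ≡ w
    earliest : ∀ {t y} → JoinedAt G t w y → proj₁ μ ≤ t
    oneSided : proj₂ μ ∈ left ∷ right ∷ []

first : ∀ G w → ∃ (IsFirst G w) ⊎ (∀ t y → ¬ JoinedAt G t w y)
first [] w = inj₂ λ t y ()
first ((_ , u , v) ∷ G) w with first G w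
... | inj₁ ((t , s) , f) = inj₁ ((t , s) , record
  { reveals  = inj₂ reveals
  ; only     = λ { (inj₁ (refl , _)) → ⊥-elim (ℕ.<-irrefl refl t<) ; (inj₂ r) → only r }
  ; earliest = λ { (inj₁ (refl , _)) → ℕ.<⇒≤ t< ; (inj₂ j) → earliest j }
  ; oneSided = oneSided
  })
  where
  open IsFirst f
  t< = reveals-< G reveals
... | inj₂ none = new (w ℕ.≟ u) (w ℕ.≟ v)
  where
  mark : ∀ s → s ∈ left ∷ right ∷ [] → End s u v w → (∀ {x} → End s u v x → x ≡ w) →
    ∃ (IsFirst ((red , u , v) ∷ G) w)
  mark s s∈ e o = (length G , s) , record
    { reveals  = inj₁ (refl , e)
    ; only     = λ { (inj₁ (_ , e′)) → o e′ ; (inj₂ r) → ⊥-elim (ℕ.<-irrefl refl (reveals-< G r)) }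
    ; earliest = λ { (inj₁ (refl , _)) → ℕ.≤-refl ; (inj₂ j) → ⊥-elim (none _ _ j) }
    ; oneSided = s∈
    }
  -- No field depends on the colour of the edge, so the record can be rebuilt field by field.
  recolour : ∀ {c} → ∃ (IsFirst ((red , u , v) ∷ G) w) → ∃ (IsFirst ((c , u , v) ∷ G) w)
  recolour (μ , f) = μ , record { IsFirst f }
  new : Dec (w ≡ u) → Dec (w ≡ v) → _
  new (yes refl) _          = inj₁ (recolour (mark left (here refl) refl λ e → e))
  new (no _)     (yes refl) = inj₁ (recolour (mark right (there (here refl)) refl λ e → e))
  new (no w≢u)   (no w≢v)   = inj₂ λ
    { t y (inj₁ (_ , inj₁ (u≡w , _))) → w≢u (sym u≡w)
    ; t y (inj₁ (_ , inj₂ (_ , v≡w))) → w≢v (sym v≡w)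
    ; t y (inj₂ j)                    → none t y j }

-- Counted turns and the number of hits.

CountedAt : List Mark → Position → ℕ → Set
CountedAt σ []                t = ⊥
CountedAt σ ((_ , u , v) ∷ G) t = (t ≡ length G × Counted σ G u v) ⊎ CountedAt σ G t

countedAt? : ∀ σ G t → Dec (CountedAt σ G t)
countedAt? σ []                t = no λ ()
countedAt? σ ((_ , u , v) ∷ G) t =
  ((t ℕ.≟ length G) ×-dec counted? σ G u v) ⊎-dec countedAt? σ G t

-- Marks of turn at most `t` refer to edges present once turn `t` is played. Equality is allowed
-- because the edge of turn `t` may itself reveal its ends.
countedAt⁺ : ∀ G {σ t x y μ ν} → JoinedAt G t x y →
  μ ∈ σ → Reveals G μ x → proj₁ μ ≤ t →
  ν ∈ σ → Reveals G ν y → proj₁ ν ≤ t → CountedAt σ G t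
countedAt⁺ (_ ∷ G) (inj₁ (t≡ , inj₁ (refl , refl))) μ∈ rx _ ν∈ ry _ =
  inj₁ (t≡ , lose μ∈ rx , lose ν∈ ry)
countedAt⁺ (_ ∷ G) (inj₁ (t≡ , inj₂ (refl , refl))) μ∈ rx _ ν∈ ry _ =
  inj₁ (t≡ , lose ν∈ ry , lose μ∈ rx)
countedAt⁺ (_ ∷ G) (inj₂ j) μ∈ (inj₁ (refl , _)) μ≤ ν∈ _ _ =
  ⊥-elim (ℕ.<⇒≱ (joinedAt-< G j) μ≤)
countedAt⁺ (_ ∷ G) (inj₂ j) μ∈ (inj₂ _) μ≤ ν∈ (inj₁ (refl , _)) ν≤ =
  ⊥-elim (ℕ.<⇒≱ (joinedAt-< G j) ν≤)
countedAt⁺ (_ ∷ G) (inj₂ j) μ∈ (inj₂ rx) μ≤ ν∈ (inj₂ ry) ν≤ =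
  inj₂ (countedAt⁺ G j μ∈ rx μ≤ ν∈ ry ν≤)

delete : ℕ → List ℕ → List ℕ
delete n = filter (λ t → ¬? (t ℕ.≟ n))

length-delete : ∀ n {L} → Unique L → length L ≤ suc (length (delete n L))
length-delete n [] = ℕ.z≤n
length-delete n {t ∷ L} (t∉ ∷ u) = go (t ℕ.≟ n)
  where
  new? = λ t → ¬? (t ℕ.≟ n)
  go : Dec (t ≡ n) → suc (length L) ≤ suc (length (delete n (t ∷ L)))
  go (yes refl) = s≤s (ℕ.≤-reflexive (cong length (sym (trans
    (filter-reject new? (λ t≢t → t≢t refl))
    (filter-all new? (All.map (λ n≢t t≡n → n≢t (sym t≡n)) t∉))))))
  go (no t≢n) = s≤s (ℕ.≤-trans (length-delete n u)
    (ℕ.≤-reflexive (cong length (sym (filter-accept new? t≢n)))))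

-- Induction on the position: the newest edge accounts for at most one of the distinct turns, and
-- after deleting that turn the rest are counted among the older edges.
length≤hits : ∀ {σ} G {L} → Unique L → All (CountedAt σ G) L → length L ≤ hits σ G
length≤hits [] {[]} u [] = ℕ.z≤n
length≤hits {σ} ((_ , u , v) ∷ G) {L} uL counted with counted? σ G u v
... | no ¬c = length≤hits G uL (All.map (λ { (inj₁ (_ , c)) → ⊥-elim (¬c c) ; (inj₂ c) → c }) counted)
... | yes _ = ℕ.≤-trans (length-delete (length G) uL) (s≤s (length≤hits G
  (Unique.filter⁺ new? uL)
  (All.zipWith (λ { (inj₁ (t≡ , _) , t≢) → ⊥-elim (t≢ t≡) ; (inj₂ c , _) → c })
    (All.filter⁺ new? counted , All.all-filter new? L))))
  where new? = λ t → ¬? (t ℕ.≟ length G)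

-- Matchings as lists of pairs, and permutations.

flat : List (ℕ × ℕ) → List ℕ
flat []             = []
flat ((a , b) ∷ ps) = a ∷ b ∷ flat ps

flat-↭ : ∀ {ps qs} → ps ↭ qs → flat ps ↭ flat qs
flat-↭ refl = refl
flat-↭ (↭.prep (a , b) p) = ↭.prep a (↭.prep b (flat-↭ p))
flat-↭ (↭.swap (a , b) (c , d) p) = ↭.trans
  (↭.trans (↭.prep a (↭.swap b c refl)) (↭.swap a c (↭.swap b d refl)))
  (↭.prep c (↭.trans (↭.swap a d refl) (↭.prep d (↭.prep a (↭.prep b (flat-↭ p))))))
flat-↭ (↭.trans p q) = ↭.trans (flat-↭ p) (flat-↭ q)

∈⇒↭ : {A : Set} {x : A} {xs : List A} → x ∈ xs → ∃[ ys ] xs ↭ x ∷ ys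
∈⇒↭ {x = x} x∈ with ∈-∃++ x∈
... | ys , zs , refl = ys ++ zs , ↭.shift x ys zs

-- Any two entries can be moved to the front, so for a permutation-invariant property such as
-- optimality only the first two need be treated.
allPairs-↭ : {A : Set} {R : A → A → Set} (xs : List A) →
  (∀ {x y zs} → xs ↭ x ∷ y ∷ zs → R x y) → AllPairs R xs
allPairs-↭ []       r = []
allPairs-↭ (x ∷ xs) r =
  All.tabulate (λ y∈ → r (↭.prep x (proj₂ (∈⇒↭ y∈)))) ∷
  allPairs-↭ xs λ p → r (↭.trans (↭.prep x p) (↭.trans (↭.swap x _ refl) (↭.prep _ (↭.swap x _ refl))))

-- No search over `A` is available, so the minimiser is obtained only under double negation, by
-- well-founded descent on `μ`.
minimum : {A : Set} {P : Set} (μ : A → ℕ) →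
  (∀ x → (∀ y → μ x ≤ μ y) → P) → A → ¬ ¬ P
minimum {A} μ found x ¬P = <-rec (λ n → ∀ x → μ x ≡ n → ⊥) descend (μ x) x refl
  where
  descend : ∀ n → (∀ {k} → k < n → ∀ x → μ x ≡ k → ⊥) → ∀ x → μ x ≡ n → ⊥
  descend n rec x refl = ¬P (found x λ y → ℕ.≮⇒≥ λ μy<μx → rec μy<μx y refl)

2^-cancel-≤ : ∀ s t → 2 ℕ.^ s ≤ 2 ℕ.^ t → s ≤ t
2^-cancel-≤ s t le = ℕ.≮⇒≥ λ t<s → ℕ.<⇒≱ (ℕ.^-monoʳ-< 2 ℕ.≤-refl t<s) le

-- If both exponents were below `t`, the two powers would sum to at most twice half of `2 ^ t`.
2^-dominated : ∀ t u v → 2 ℕ.^ t < 2 ℕ.^ u + 2 ℕ.^ v → t ≤ u ⊎ t ≤ v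
2^-dominated t u v lt with t ℕ.≤? u | t ℕ.≤? v
... | yes t≤u | _       = inj₁ t≤u
... | no _    | yes t≤v = inj₂ t≤v
... | no t≰u  | no t≰v  = ⊥-elim (ℕ.<⇒≱ lt (small t (ℕ.≰⇒> t≰u) (ℕ.≰⇒> t≰v)))
  where
  small : ∀ t → u < t → v < t → 2 ℕ.^ u + 2 ℕ.^ v ≤ 2 ℕ.^ t
  small (suc t) (s≤s u≤t) (s≤s v≤t) = subst (2 ℕ.^ u + 2 ℕ.^ v ≤_)
    (cong (2 ℕ.^ t +_) (sym (ℕ.+-identityʳ (2 ℕ.^ t))))
    (ℕ.+-mono-≤ (ℕ.^-monoʳ-≤ 2 u≤t) (ℕ.^-monoʳ-≤ 2 v≤t))

-- Here `x` is the cost of the untouched pairs. The larger power on the left is strictly below the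
-- left sum, since the other one is positive; then `2^-dominated` applies.
2^-exchange : ∀ s t u v x → 2 ℕ.^ s + (2 ℕ.^ t + x) ≤ 2 ℕ.^ u + (2 ℕ.^ v + x) →
  s ⊔ t ≤ u ⊎ s ⊔ t ≤ v
2^-exchange s t u v x le = 2^-dominated (s ⊔ t) u v
  (ℕ.<-≤-trans max< (ℕ.+-cancelʳ-≤ x _ _
    (subst₂ _≤_ (sym (ℕ.+-assoc (2 ℕ.^ s) _ x)) (sym (ℕ.+-assoc (2 ℕ.^ u) _ x)) le)))
  where
  max< : 2 ℕ.^ (s ⊔ t) < 2 ℕ.^ s + 2 ℕ.^ t
  max< with ℕ.⊔-sel s t
  ... | inj₁ eq rewrite eq = ℕ.m<m+n (2 ℕ.^ s) (ℕ.m^n>0 2 t)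
  ... | inj₂ eq rewrite eq = ℕ.m<n+m (2 ℕ.^ t) (ℕ.m^n>0 2 s)

exchange : {A : Set} (x y : A) (xs ys : List A) → x ∷ xs ++ y ∷ ys ↭ y ∷ xs ++ x ∷ ys
exchange x y xs ys = ↭.trans (↭.prep x (↭.shift y xs ys))
  (↭.trans (↭.swap x y refl) (↭.prep y (↭-sym (↭.shift x xs ys))))

-- Matchings of minimum cost.

module Matching (τ : ℕ → ℕ → ℕ) where

  cost : List (ℕ × ℕ) → ℕ
  cost ps = sum (map (λ (a , b) → 2 ℕ.^ τ a b) ps)

  -- The weights 2^τ make the later edge decisive: if 2^t < 2^u + 2^v, then
  -- t ≤ u or t ≤ v.
  Optimal : List (ℕ × ℕ) → List ℕ → Set
  Optimal ps ws = ∀ qs vs → flat qs ++ vs ↭ flat ps ++ ws → length qs ≡ length ps →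
    cost ps ≤ cost qs

  optimal-↭ : ∀ {ps ws qs vs} → ps ↭ qs → ws ↭ vs → Optimal ps ws → Optimal qs vs
  optimal-↭ p w opt rs us perm len = subst (_≤ cost rs) (sum-↭ (↭.map⁺ _ p))
    (opt rs us (↭.trans perm (↭-sym (↭.++⁺ (flat-↭ p) w))) (trans len (sym (↭.↭-length p))))

  optimal-exists : ∀ {P : Set} ps ws →
    (∀ qs vs → flat qs ++ vs ↭ flat ps ++ ws → length qs ≡ length ps → Optimal qs vs → P) →
    ¬ ¬ P
  optimal-exists {P} ps ws found = minimum {A} (cost ∘ proj₁)
    (λ (qs , vs , perm , len) least → found qs vs perm len λ rs us perm′ len′ →
      least (rs , us , ↭.trans perm′ perm , trans len′ len))
    (ps , ws , refl , refl)
    where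
    A = ∃[ qs ] ∃[ vs ] flat qs ++ vs ↭ flat ps ++ ws × length qs ≡ length ps

  Triangle : ℕ × ℕ → ℕ → Set
  Triangle (a , b) w = τ a b ≤ τ a w × τ a b ≤ τ b w

  -- Replacing `b` by `w` as the partner of `a`, or `a` by `w` as the partner of `b`, gives a
  -- matching of the same size; the remaining costs cancel.
  optimal-triangle : ∀ {a b ps w ws} → Optimal ((a , b) ∷ ps) (w ∷ ws) → Triangle (a , b) w
  optimal-triangle {a} {b} {ps} {w} {ws} opt =
    beat a w b (↭.prep a (exchange w b (flat ps) ws)) ,
    beat b w a (↭.trans (↭.prep b (exchange w a (flat ps) ws)) (↭.swap b a refl))
    where
    beat : ∀ x y z → x ∷ y ∷ flat ps ++ z ∷ ws ↭ a ∷ b ∷ flat ps ++ w ∷ ws → τ a b ≤ τ x y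
    beat x y z perm = 2^-cancel-≤ _ _
      (ℕ.+-cancelʳ-≤ (cost ps) _ _ (opt ((x , y) ∷ ps) (z ∷ ws) perm refl))

  Square : ℕ × ℕ → ℕ × ℕ → Set
  Square (a , b) (c , d) =
    (τ a b ⊔ τ c d ≤ τ a c ⊎ τ a b ⊔ τ c d ≤ τ b d) ×
    (τ a b ⊔ τ c d ≤ τ a d ⊎ τ a b ⊔ τ c d ≤ τ b c)

  -- Compare with the two rematchings `ac`, `bd` and `ad`, `bc`: each must contain an edge at least
  -- as late as both `ab` and `cd`.
  optimal-square : ∀ {a b c d ps ws} → Optimal ((a , b) ∷ (c , d) ∷ ps) ws →
    Square (a , b) (c , d)
  optimal-square {a} {b} {c} {d} {ps} {ws} opt =
    2^-exchange (τ a b) (τ c d) _ _ _ (opt ((a , c) ∷ (b , d) ∷ ps) ws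
      (↭.prep a (↭.swap c b refl)) refl) ,
    2^-exchange (τ a b) (τ c d) _ _ _ (opt ((a , d) ∷ (b , c) ∷ ps) ws
      (↭.prep a (↭.trans (↭.swap d b refl) (↭.prep b (↭.swap d c refl)))) refl)

  optimal⇒triangles : ∀ {ps ws} → Optimal ps ws → ∀ {p w} → p ∈ ps → w ∈ ws → Triangle p w
  optimal⇒triangles opt p∈ w∈ with ∈⇒↭ p∈ | ∈⇒↭ w∈
  ... | qs , p↭ | vs , w↭ = optimal-triangle {ps = qs} {ws = vs} (optimal-↭ p↭ w↭ opt)

  optimal⇒squares : ∀ {ps ws} → Optimal ps ws → AllPairs Square ps
  optimal⇒squares {ps} opt =
    allPairs-↭ ps λ {_ _ qs} perm → optimal-square {ps = qs} (optimal-↭ perm refl opt)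

  turns : List ℕ → List ℕ
  turns []       = []
  turns (x ∷ xs) = map (τ x) xs ++ turns xs

  -- Counting good pairs around a matching.

  module Count {P : ℕ → Set} (P? : ∀ t → Dec (P t)) where

    indicator : ℕ → ℕ
    indicator t with P? t
    ... | yes _ = 1
    ... | no _  = 0

    count : List ℕ → ℕ
    count = sum ∘ map indicator

    count-filter : ∀ L → count L ≡ length (filter P? L)
    count-filter [] = refl
    count-filter (t ∷ L) with P? t
    ... | yes _ = cong suc (count-filter L)
    ... | no _  = count-filter L

    count-++ : ∀ L M → count (L ++ M) ≡ count L + count M
    count-++ []      M = refl
    count-++ (t ∷ L) M = trans (cong (indicator t +_) (count-++ L M))
      (sym (ℕ.+-assoc (indicator t) (count L) (count M)))

    indicator-yes : ∀ {t} → P t → 1 ≤ indicator t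
    indicator-yes {t} p with P? t
    ... | yes _ = ℕ.≤-refl
    ... | no ¬p = ⊥-elim (¬p p)

    indicator-or : ∀ {t u} → P t ⊎ P u → 1 ≤ indicator t + indicator u
    indicator-or {t} {u} (inj₁ p) = ℕ.m≤n⇒m≤n+o (indicator u) (indicator-yes p)
    indicator-or {t} {u} (inj₂ p) = ℕ.m≤n⇒m≤o+n (indicator t) (indicator-yes p)

    SquareP : ℕ × ℕ → ℕ × ℕ → Set
    SquareP (a , b) (c , d) = (P (τ a c) ⊎ P (τ b d)) × (P (τ a d) ⊎ P (τ b c))

    TriangleP : ℕ × ℕ → ℕ → Set
    TriangleP (a , b) w = P (τ a w) × P (τ b w)

    -- Every other matching edge gives one good pair from each of its two alternatives, and every
    -- remaining vertex gives two. So the pairs leaving `ab` include at most `2 * length ps` bad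
    -- ones.
    row : ∀ {a b} ps ws → All (SquareP (a , b)) ps → All (TriangleP (a , b)) ws →
      2 * (length ps + length ws) ≤
        count (map (τ a) (flat ps ++ ws)) + count (map (τ b) (flat ps ++ ws))
    row [] [] [] [] = z≤n
    row {a} {b} [] (w ∷ ws) [] ((pa , pb) ∷ ts) = subst₂ _≤_
      (sym (ℕ.*-suc 2 (length ws)))
      (solve 4 (λ i j x y → (i :+ j) :+ (x :+ y) := (i :+ x) :+ (j :+ y)) refl
        (indicator (τ a w)) (indicator (τ b w)) _ _)
      (ℕ.+-mono-≤ (ℕ.+-mono-≤ (indicator-yes pa) (indicator-yes pb)) (row [] ws [] ts))
      where open ℕSolver.+-*-Solver
    row {a} {b} ((c , d) ∷ ps) ws ((p , q) ∷ ss) ts = subst₂ _≤_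
      (sym (ℕ.*-suc 2 (length ps + length ws)))
      (solve 6 (λ i j k l x y → ((i :+ j) :+ (k :+ l)) :+ (x :+ y) :=
                                (i :+ (k :+ x)) :+ (l :+ (j :+ y))) refl
        (indicator (τ a c)) (indicator (τ b d)) (indicator (τ a d)) (indicator (τ b c)) _ _)
      (ℕ.+-mono-≤ (ℕ.+-mono-≤ (indicator-or p) (indicator-or q)) (row ps ws ss ts))
      where open ℕSolver.+-*-Solver

    count-all : ∀ {L} → All P L → length L ≤ count L
    count-all []       = z≤n
    count-all (p ∷ ps) = ℕ.+-mono-≤ (indicator-yes p) (count-all ps)

    [1+n]C2 : ∀ n → suc n C 2 ≡ n + n C 2
    [1+n]C2 n = trans (sym (nCk+nC[k+1]≡[n+1]C[k+1] n 1)) (cong (_+ n C 2) (nC1≡n n))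

    count-clique : ∀ {ws} → AllPairs (λ x y → P (τ x y)) ws → length ws C 2 ≤ count (turns ws)
    count-clique [] = z≤n
    count-clique {w ∷ ws} (p ∷ ps) = begin
      suc (length ws) C 2                   ≡⟨ [1+n]C2 (length ws) ⟩
      length ws + length ws C 2             ≡⟨ cong (_+ length ws C 2) (length-map (τ w) ws) ⟨
      length (map (τ w) ws) + length ws C 2 ≤⟨ ℕ.+-mono-≤ (count-all (All.map⁺ p)) (count-clique ps) ⟩
      count (map (τ w) ws) + count (turns ws) ≡⟨ count-++ (map (τ w) ws) (turns ws) ⟨
      count (turns (w ∷ ws)) ∎
      where open ℕ.≤-Reasoning

    -- Induction on the matching. Prepending an edge to `c` others adds at most `2c` bad pairs by
    -- `row`, and these allowances sum to `c(c - 1)` for a matching of size `c`.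
    count-matching : ∀ {ps ws} → All (λ (a , b) → P (τ a b)) ps → AllPairs SquareP ps →
      (∀ {p w} → p ∈ ps → w ∈ ws → TriangleP p w) → AllPairs (λ x y → P (τ x y)) ws →
      (2 * length ps + length ws) C 2 ≤
        count (turns (flat ps ++ ws)) + length ps * (length ps ∸ 1)
    count-matching {[]} {ws} [] [] ts cl = ℕ.≤-trans (count-clique cl) (ℕ.m≤m+n _ 0)
    count-matching {(a , b) ∷ ps} {ws} (e ∷ es) (s ∷ ss) ts cl = begin
      (2 * suc c + k) C 2
        ≡⟨ cong (λ n → (n + k) C 2) (ℕ.*-suc 2 c) ⟩
      suc (suc n) C 2
        ≡⟨ trans ([1+n]C2 (suc n)) (cong (suc n +_) ([1+n]C2 n)) ⟩
      suc n + (n + n C 2)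
        ≤⟨ ℕ.+-monoʳ-≤ (suc n) (ℕ.+-monoʳ-≤ n (count-matching es ss (ts ∘ there) cl)) ⟩
      suc n + (n + (T + c * (c ∸ 1)))
        -- Of the pairs at `a` or `b`, `2c` are moved into the allowance; `ab` itself and `2(c + k)`
        -- others remain to be found good.
        ≡⟨ solve 4 (λ c k t x → con 1 :+ (con 2 :* c :+ k) :+ ((con 2 :* c :+ k) :+ (t :+ x)) :=
             con 1 :+ con 2 :* (c :+ k) :+ t :+ (con 2 :* c :+ x)) refl c k T (c * (c ∸ 1)) ⟩
      1 + 2 * (c + k) + T + (2 * c + c * (c ∸ 1))
        ≤⟨ ℕ.+-mono-≤ (ℕ.+-monoˡ-≤ T (ℕ.+-mono-≤ (indicator-yes e) (row ps ws s (All.tabulate (ts (here refl))))))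
             (ℕ.≤-reflexive (square c)) ⟩
      indicator (τ a b) + (A + B) + T + suc c * c
        ≡⟨ cong (_+ suc c * c) (solve 4 (λ i x y t → i :+ (x :+ y) :+ t := (i :+ x) :+ (y :+ t)) refl
             (indicator (τ a b)) A B T) ⟩
      (indicator (τ a b) + A) + (B + T) + suc c * c
        ≡⟨ cong (_+ suc c * c) (cong ((indicator (τ a b) + A) +_) (count-++ (map (τ b) zs) (turns zs))) ⟨
      count (map (τ a) (b ∷ zs)) + count (map (τ b) zs ++ turns zs) + suc c * c
        ≡⟨ cong (_+ suc c * c) (count-++ (map (τ a) (b ∷ zs)) (map (τ b) zs ++ turns zs)) ⟨
      count (turns (a ∷ b ∷ zs)) + suc c * c ∎
      where
      open ℕ.≤-Reasoning
      open ℕSolver.+-*-Solver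
      c = length ps
      k = length ws
      n = 2 * c + k
      zs = flat ps ++ ws
      T = count (turns zs)
      A = count (map (τ a) zs)
      B = count (map (τ b) zs)
      square : ∀ c → 2 * c + c * (c ∸ 1) ≡ suc c * c
      square zero    = refl
      square (suc c) = solve 1 (λ c → con 2 :* (con 1 :+ c) :+ (con 1 :+ c) :* c :=
        (con 1 :+ (con 1 :+ c)) :* (con 1 :+ c)) refl c

-- Enumeration of the specifications.

length-cartesianProductWith : ∀ {A B R : Set} (f : A → B → R) xs ys →
  length (cartesianProductWith f xs ys) ≡ length xs * length ys
length-cartesianProductWith f []       ys = refl
length-cartesianProductWith f (x ∷ xs) ys = trans (length-++ (map (f x) ys))
  (cong₂ _+_ (length-map (f x) ys) (length-cartesianProductWith f xs ys))

tuples : {A : Set} → List A → ℕ → List (List A)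
tuples L zero    = [] ∷ []
tuples L (suc k) = cartesianProductWith _∷_ L (tuples L k)

length-tuples : ∀ {A : Set} (L : List A) k → length (tuples L k) ≡ length L ℕ.^ k
length-tuples L zero    = refl
length-tuples L (suc k) = trans (length-cartesianProductWith _∷_ L (tuples L k))
  (cong (length L *_) (length-tuples L k))

∈-tuples : ∀ {A : Set} {L xs : List A} {k} → All (_∈ L) xs → length xs ≡ k → xs ∈ tuples L k
∈-tuples []         refl = here refl
∈-tuples (x∈ ∷ xs∈) refl = ∈-cartesianProductWith⁺ _∷_ x∈ (∈-tuples xs∈ refl)

edgeMarks vertexMarks : ℕ → List Mark
edgeMarks   N = cartesianProduct (upTo N) (both ∷ [])
vertexMarks N = cartesianProduct (upTo N) (left ∷ right ∷ [])

specs : ℕ → ℕ → ℕ → List (List Mark)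
specs N c k = cartesianProductWith _++_ (tuples (edgeMarks N) c) (tuples (vertexMarks N) k)

-- A vertex mark has `2N` choices. An edge mark has only `N`, and is bounded by `2N` too so that the
-- powers combine.
length-specs : ∀ N c k → length (specs N c k) ≤ (2 * N) ℕ.^ (c + k)
length-specs N c k = begin
  length (specs N c k)
    ≡⟨ length-cartesianProductWith _++_ (tuples (edgeMarks N) c) (tuples (vertexMarks N) k) ⟩
  length (tuples (edgeMarks N) c) * length (tuples (vertexMarks N) k)
    ≡⟨ cong₂ _*_ (length-tuples (edgeMarks N) c) (length-tuples (vertexMarks N) k) ⟩
  length (edgeMarks N) ℕ.^ c * length (vertexMarks N) ℕ.^ k
    ≤⟨ ℕ.*-mono-≤ (ℕ.^-monoˡ-≤ c (marks (both ∷ []) (s≤s z≤n)))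
                  (ℕ.^-monoˡ-≤ k (marks (left ∷ right ∷ []) ℕ.≤-refl)) ⟩
  (2 * N) ℕ.^ c * (2 * N) ℕ.^ k
    ≡⟨ ℕ.^-distribˡ-+-* (2 * N) c k ⟨
  (2 * N) ℕ.^ (c + k) ∎
  where
  open ℕ.≤-Reasoning
  marks : ∀ (L : List Side) → length L ≤ 2 → length (cartesianProduct (upTo N) L) ≤ 2 * N
  marks L le = begin
    length (cartesianProduct (upTo N) L) ≡⟨ length-cartesianProductWith _,_ (upTo N) L ⟩
    length (upTo N) * length L           ≡⟨ cong (_* length L) (length-upTo N) ⟩
    N * length L                         ≤⟨ ℕ.*-monoʳ-≤ N le ⟩
    N * 2                                ≡⟨ ℕ.*-comm N 2 ⟩
    2 * N                                ∎

-- Simple positions and pairs inside a clique.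

Simple : Position → Set
Simple []                = ⊤
Simple ((_ , u , v) ∷ G) = u ≢ v × ¬ Adjacent G u v × Simple G

simple-colour : ∀ G {c c′ u v} → Simple G → (c′ , u , v) ∈ G → Edge G c u v → c ≡ c′
simple-colour (_ ∷ G) (_ , na , s) (here refl) (inj₁ (here refl)) = refl
simple-colour (_ ∷ G) (_ , na , s) (here refl) (inj₂ (here refl)) = refl
simple-colour (_ ∷ G) (_ , na , s) (here refl) (inj₁ (there e))   = ⊥-elim (na (_ , inj₁ e))
simple-colour (_ ∷ G) (_ , na , s) (here refl) (inj₂ (there e))   = ⊥-elim (na (_ , inj₂ e))
simple-colour (_ ∷ G) (_ , na , s) (there e′)  (inj₁ (here refl)) = ⊥-elim (na (_ , inj₁ e′))
simple-colour (_ ∷ G) (_ , na , s) (there e′)  (inj₂ (here refl)) = ⊥-elim (na (_ , inj₂ e′))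
simple-colour (_ ∷ G) (_ , na , s) (there e′)  (inj₁ (there e))   = simple-colour G s e′ (inj₁ e)
simple-colour (_ ∷ G) (_ , na , s) (there e′)  (inj₂ (there e))   = simple-colour G s e′ (inj₂ e)

simple-loopless : ∀ G {c u v} → Simple G → (c , u , v) ∈ G → u ≢ v
simple-loopless (_ ∷ G) (u≢v , _)   (here refl) = u≢v
simple-loopless (_ ∷ G) (_ , _ , s) (there e)   = simple-loopless G s e

allPairs-zip : ∀ {A : Set} {P : A → Set} {R : A → A → Set} {xs} →
  All P xs → AllPairs R xs → AllPairs (λ x y → P x × P y × R x y) xs
allPairs-zip []       []       = []
allPairs-zip (p ∷ ps) (r ∷ rs) =
  All.zipWith (λ (q , s) → p , q , s) (ps , r) ∷ allPairs-zip ps rs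

allPairs-lookup : ∀ {A : Set} {R : A → A → Set} {xs x y} → (∀ {u v} → R u v → R v u) →
  AllPairs R xs → x ∈ xs → y ∈ xs → x ≢ y → R x y
allPairs-lookup sym (r ∷ rs) (here refl) (here refl) x≢y = ⊥-elim (x≢y refl)
allPairs-lookup sym (r ∷ rs) (here refl) (there y∈)  x≢y = All.lookup r y∈
allPairs-lookup sym (r ∷ rs) (there x∈)  (here refl) x≢y = sym (All.lookup r x∈)
allPairs-lookup sym (r ∷ rs) (there x∈)  (there y∈)  x≢y = allPairs-lookup sym rs x∈ y∈ x≢y

-- Supplies the arbitrary matching of size `c` from which the minimisation starts.
pairUp : ∀ c k (xs : List ℕ) → length xs ≡ 2 * c + k →
  ∃[ ps ] ∃[ ws ] flat ps ++ ws ≡ xs × length ps ≡ c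
pairUp zero    k xs len = [] , xs , refl , refl
pairUp (suc c) k xs len = go xs (trans len (cong (_+ k) (ℕ.*-suc 2 c)))
  where
  go : ∀ xs → length xs ≡ 2 + 2 * c + k →
    ∃[ ps ] ∃[ ws ] flat ps ++ ws ≡ xs × length ps ≡ suc c
  go (x ∷ y ∷ zs) len with pairUp c k zs (ℕ.suc-injective (ℕ.suc-injective len))
  ... | ps , ws , refl , refl = (x , y) ∷ ps , ws , refl , refl

length-flat : ∀ ps (ws : List ℕ) → length (flat ps ++ ws) ≡ 2 * length ps + length ws
length-flat []             ws = refl
length-flat ((a , b) ∷ ps) ws = trans (cong (2 +_) (length-flat ps ws))
  (cong (_+ length ws) (sym (ℕ.*-suc 2 (length ps))))

module _ {R : ℕ → ℕ → Set} where

  Across : ℕ × ℕ → ℕ × ℕ → Set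
  Across (a , b) (c , d) = R a c × R a d × R b c × R b d

  unflat-here : ∀ {a} ps ws → All (R a) (flat ps ++ ws) →
    All (λ (c , d) → R a c × R a d) ps × All (R a) ws
  unflat-here []       ws rs           = [] , rs
  unflat-here (_ ∷ ps) ws (r ∷ s ∷ rs) = Product.map₁ ((r , s) ∷_) (unflat-here ps ws rs)

  unflat : ∀ ps ws → AllPairs R (flat ps ++ ws) →
    All (λ (a , b) → R a b) ps × AllPairs Across ps ×
    All (λ (a , b) → All (λ w → R a w × R b w) ws) ps × AllPairs R ws
  unflat []             ws rs = [] , [] , [] , rs
  unflat ((a , b) ∷ ps) ws ((r ∷ ra) ∷ rb ∷ rs)
    with unflat-here ps ws ra | unflat-here ps ws rb | unflat ps ws rs
  ... | pa , wa | pb , wb | es , ss , ts , cl =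
    r ∷ es ,
    All.zipWith (λ ((x , y) , (z , w)) → x , y , z , w) (pa , pb) ∷ ss ,
    All.zip (wa , wb) ∷ ts , cl

-- The default `(0 , left)` is for isolated vertices and does not arise in a clique with at least
-- two vertices.
firstMark : Position → ℕ → Mark
firstMark G w = [ proj₁ , const (0 , left) ]′ (first G w)

isFirst : ∀ {G t w y} → JoinedAt G t w y → IsFirst G w (firstMark G w)
isFirst {G} {w = w} j with first G w
... | inj₁ (_ , f) = f
... | inj₂ none    = ⊥-elim (none _ _ j)

module _ {G : Position} where

  open Matching (turnOf G)

  turns-all : ∀ {R : ℕ → ℕ → Set} {Q : ℕ → Set} → (∀ {x y} → R x y → Q (turnOf G x y)) →
    ∀ {xs} → AllPairs R xs → All Q (turns xs)
  turns-all f []       = []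
  turns-all f (r ∷ rs) = All.++⁺ (All.map⁺ (All.map f r)) (turns-all f rs)

  private
    D : ℕ → ℕ → Set
    D x y = x ≢ y × JoinedAt G (turnOf G x y) x y

  turnOf-injective : ∀ {x y u v} → D x y → D u v → turnOf G x y ≡ turnOf G u v → Joins x y u v
  turnOf-injective {u = u} {v} (_ , j) (_ , j′) eq =
    joinedAt-unique G j (subst (λ t → JoinedAt G t u v) (sym eq) j′)

  -- A turn determines its edge up to orientation, and different pairs from a list of distinct
  -- vertices are different edges.
  turns-unique : ∀ {xs} → AllPairs D xs → Unique (turns xs)
  turns-unique [] = []
  turns-unique {x ∷ xs} (d ∷ ds) = AllPairs.++⁺
    (AllPairs.map⁺ (AllPairs.map
      (λ { (dy , dz , y≢z , _) eq → sameRow dy dz y≢z (turnOf-injective dy dz eq) })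
      (allPairs-zip d ds)))
    (turns-unique ds)
    (All.map⁺ (All.map (λ dy → turns-all
      (λ { (du , dv , duv) eq → otherRow du dv (turnOf-injective dy duv eq) })
      (allPairs-zip d ds)) d))
    where
    sameRow : ∀ {y z} → D x y → D x z → y ≢ z → ¬ Joins x y x z
    sameRow _        _        y≢z (inj₁ (_ , y≡z)) = y≢z y≡z
    sameRow _        (x≢z , _) _  (inj₂ (x≡z , _)) = x≢z x≡z
    otherRow : ∀ {y u v} → D x u → D x v → ¬ Joins x y u v
    otherRow (x≢u , _) _         (inj₁ (x≡u , _)) = x≢u x≡u
    otherRow _         (x≢v , _) (inj₂ (x≡v , _)) = x≢v x≡v

-- The specification charged by a monochromatic clique.

module _ {G : Position} {N : ℕ} (simple : Simple G) (short : length G ≤ N) where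

  private
    τ = turnOf G
  open Matching τ

  module _ {c₀ xs} (2≤xs : 2 ≤ length xs)
    (clique : AllPairs (λ u v → u ≢ v × Edge G c₀ u v) xs) where

    private
      joined : ∀ {x y} → x ∈ xs → y ∈ xs → x ≢ y → JoinedAt G (τ x y) x y
      joined x∈ y∈ x≢y = turnOf-joined G (c₀ , proj₂ (allPairs-lookup
        (λ (u≢v , e) → u≢v ∘ sym , Sum.swap e) clique x∈ y∈ x≢y))

      D : ℕ → ℕ → Set
      D x y = x ∈ xs × y ∈ xs × x ≢ y

      joinedᴰ : ∀ {x y} → D x y → JoinedAt G (τ x y) x y
      joinedᴰ (x∈ , y∈ , x≢y) = joined x∈ y∈ x≢y

      τ< : ∀ {x y} → D x y → τ x y < N
      τ< d = ℕ.<-≤-trans (joinedAt-< G (joinedᴰ d)) short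

      -- Guarantees that each clique vertex has an edge, hence a genuine first mark; this is where
      -- two vertices are required.
      partner : ∀ w → ∃[ y ] (y ∈ xs × w ≢ y)
      partner w = go 2≤xs clique
        where
        go : ∀ {ys} → 2 ≤ length ys → AllPairs (λ u v → u ≢ v × Edge G c₀ u v) ys →
          ∃[ y ] (y ∈ ys × w ≢ y)
        go {x ∷ y ∷ _} _ (((x≢y , _) ∷ _) ∷ _) with w ℕ.≟ x
        ... | yes refl = y , there (here refl) , x≢y
        ... | no w≢x   = x , here refl , w≢x
        go {_ ∷ []} (s≤s ()) _

      isFirst-∈ : ∀ {w} → w ∈ xs → IsFirst G w (firstMark G w)
      isFirst-∈ {w} w∈ = let y , y∈ , w≢y = partner w in isFirst (joined w∈ y∈ w≢y)

    spec : List (ℕ × ℕ) → List ℕ → List Mark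
    spec ps ws = map (λ (a , b) → τ a b , both) ps ++ map (firstMark G) ws

    module _ {ps ws} (perm : flat ps ++ ws ↭ xs) (opt : Optimal ps ws) where

      private
        ys = flat ps ++ ws
        σ = spec ps ws

        ys⊆xs : ∀ {x} → x ∈ ys → x ∈ xs
        ys⊆xs = ↭.∈-resp-↭ perm

        ys-unique : Unique ys
        ys-unique = Permutation.Unique-resp-↭ (setoid ℕ) (↭⇒↭ₛ (↭-sym perm)) (AllPairs.map proj₁ clique)

        D-ys : AllPairs D ys
        D-ys = allPairs-zip (All.tabulate ys⊆xs) ys-unique

        un = unflat ps ws D-ys
        es = proj₁ un
        ss = proj₁ (proj₂ un)
        ts = proj₁ (proj₂ (proj₂ un))
        cl = proj₂ (proj₂ (proj₂ un))

        edge-∈ : ∀ {a b} → (a , b) ∈ ps → (τ a b , both) ∈ σ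
        edge-∈ p∈ = ∈-++⁺ˡ (∈-map⁺ _ p∈)

        vertex-∈ : ∀ {w} → w ∈ ws → firstMark G w ∈ σ
        vertex-∈ w∈ = ∈-++⁺ʳ (map _ ps) (∈-map⁺ _ w∈)

        ws⊆xs : ∀ {w} → w ∈ ws → w ∈ xs
        ws⊆xs = ys⊆xs ∘ ∈-++⁺ʳ (flat ps)

        ends : ∀ {a b} → (a , b) ∈ ps → _
        ends {a} {b} p∈ = reveals-both G {τ a b} {a} {b} (joinedᴰ (All.lookup es p∈))

      spec-∈ : spec ps ws ∈ specs N (length ps) (length ws)
      spec-∈ = ∈-cartesianProductWith⁺ _++_
        (∈-tuples (All.map⁺ (All.map (λ d → ∈-cartesianProduct⁺ (∈-upTo⁺ (τ< d)) (here refl)) es))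
          (length-map _ ps))
        (∈-tuples (All.map⁺ (All.tabulate λ w∈ → let open IsFirst (isFirst-∈ (ws⊆xs w∈)) in
            ∈-cartesianProduct⁺ (∈-upTo⁺ (ℕ.<-≤-trans (reveals-< G reveals) short)) oneSided))
          (length-map _ ws))

      -- An edge mark reveals just the two ends of a matching edge and a first mark just its own
      -- vertex. Hence no edge leaving the clique is counted.
      known⊆clique : ∀ {x} → Known (spec ps ws) G x → x ∈ xs
      known⊆clique k with Any.++⁻ (map _ ps) k
      ... | inj₁ kp with find (Any.map⁻ kp)
      ...   | (a , b) , p∈ , r with proj₂ (proj₂ (ends p∈)) r
      ...     | inj₁ refl = proj₁ (All.lookup es p∈)
      ...     | inj₂ refl = proj₁ (proj₂ (All.lookup es p∈))
      known⊆clique k | inj₂ kw with find (Any.map⁻ kw)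
      ...   | w , w∈ , r = subst (_∈ xs) (sym (IsFirst.only (isFirst-∈ (ws⊆xs w∈)) r)) (ws⊆xs w∈)

      open Count (countedAt? (spec ps ws) G)

      private
        P : ℕ → Set
        P = CountedAt (spec ps ws) G

        -- A matching edge is counted through its own mark, which reveals both ends at that very
        -- turn.
        edges-counted : All (λ (a , b) → P (τ a b)) ps
        edges-counted = All.tabulate λ p∈ → let ra , rb , _ = ends p∈ in
          countedAt⁺ G (joinedᴰ (All.lookup es p∈))
            (edge-∈ p∈) ra ℕ.≤-refl (edge-∈ p∈) rb ℕ.≤-refl

        triangles-counted : ∀ {p w} → p ∈ ps → w ∈ ws → TriangleP p w
        triangles-counted p∈ w∈ =
          let ra , rb , _ = ends p∈
              daw , dbw   = All.lookup (All.lookup ts p∈) w∈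
              ≤aw , ≤bw   = optimal⇒triangles opt p∈ w∈
              open IsFirst (isFirst-∈ (ws⊆xs w∈))
              -- The edge from `x` to `w` cannot precede the first edge at `w`.
              early       = λ {x} (d : D x _) → earliest (joinedAt-sym G (joinedᴰ d))
          in countedAt⁺ G (joinedᴰ daw) (edge-∈ p∈) ra ≤aw (vertex-∈ w∈) reveals (early daw)
           , countedAt⁺ G (joinedᴰ dbw) (edge-∈ p∈) rb ≤bw (vertex-∈ w∈) reveals (early dbw)

        square-counted : ∀ {p q} → p ∈ ps × q ∈ ps × (Across {D} p q × Square p q) → SquareP p q
        square-counted {a , b} {c , d} (p∈ , q∈ , (dac , dad , dbc , dbd) , acbd , adbc) =
          let ra , rb , _ = ends p∈
              rc , rd , _ = ends q∈
              counts : ∀ {x y} → D x y → Reveals G (τ a b , both) x → Reveals G (τ c d , both) y →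
                τ a b ⊔ τ c d ≤ τ x y → P (τ x y)
              counts δ rx ry le = countedAt⁺ G (joinedᴰ δ)
                (edge-∈ p∈) rx (ℕ.m⊔n≤o⇒m≤o _ (τ c d) le) (edge-∈ q∈) ry (ℕ.m⊔n≤o⇒n≤o (τ a b) _ le)
          in Sum.map (counts dac ra rc) (counts dbd rb rd) acbd
           , Sum.map (counts dad ra rd) (counts dbc rb rc) adbc

        squares-counted : AllPairs SquareP ps
        squares-counted = AllPairs.map square-counted
          (allPairs-zip (All.tabulate id) (AllPairs.zip (ss , optimal⇒squares opt)))

        cliques-counted : AllPairs (λ x y → P (τ x y)) ws
        cliques-counted = AllPairs.map
          (λ { (w∈ , v∈ , d) →
            let module W = IsFirst (isFirst-∈ (ws⊆xs w∈))
                module V = IsFirst (isFirst-∈ (ws⊆xs v∈))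
                j = joinedᴰ d
            in countedAt⁺ G j (vertex-∈ w∈) W.reveals (W.earliest j)
                 (vertex-∈ v∈) V.reveals (V.earliest (joinedAt-sym G j)) })
          (allPairs-zip (All.tabulate id) cl)

      -- The good turns among the pairs of the clique are distinct and counted, so each is a
      -- separate hit; `count-matching` bounds their number below.
      pairs≤hits : length xs C 2 ∸ length ps * (length ps ∸ 1) ≤ hits (spec ps ws) G
      pairs≤hits = begin
        length xs C 2 ∸ e
          ≡⟨ cong (λ n → n C 2 ∸ e) (trans (sym (↭.↭-length perm)) (length-flat ps ws)) ⟩
        (2 * length ps + length ws) C 2 ∸ e
          ≤⟨ ℕ.∸-monoˡ-≤ e (count-matching edges-counted squares-counted triangles-counted cliques-counted) ⟩
        count (turns ys) + e ∸ e
          ≡⟨ ℕ.m+n∸n≡m (count (turns ys)) e ⟩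
        count (turns ys)
          ≡⟨ count-filter (turns ys) ⟩
        length (filter (countedAt? σ G) (turns ys))
          ≤⟨ length≤hits G (Unique.filter⁺ (countedAt? σ G)
               (turns-unique (AllPairs.map (λ d → proj₂ (proj₂ d) , joinedᴰ d) D-ys)))
               (All.all-filter (countedAt? σ G) (turns ys)) ⟩
        hits σ G ∎
        where
        open ℕ.≤-Reasoning
        e = length ps * (length ps ∸ 1)

      -- The specification survives by `status-alive`, and there are enough hits to exhaust its
      -- quota; its weight is therefore 1.
      spec-complete : status c₀ (length xs C 2 ∸ length ps * (length ps ∸ 1)) (spec ps ws) G ≡ just 0
      spec-complete = trans
        (status-alive (_∈ xs) G known⊆clique λ e u∈ v∈ → simple-colour G simple e
          (proj₂ (allPairs-lookup (λ (u≢v , e) → u≢v ∘ sym , Sum.swap e) clique u∈ v∈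
            (simple-loopless G simple e))))
        (cong just (ℕ.m≤n⇒m∸n≡0 pairs≤hits))

  clique⇒1≤potential : ∀ {c₀ m c r} → 0ℚ ℚ.≤ r → 2 ≤ m → 2 * c ≤ m → HasClique c₀ m G →
    1ℚ ℚ.≤ potential c₀ r (m C 2 ∸ c * (c ∸ 1)) (specs N c (m ∸ 2 * c)) G
  clique⇒1≤potential {c₀} {c = c} {r} 0≤r 2≤m 2c≤m (xs , refl , clique) =
    -- The optimal matching exists only under double negation, which is removed here because
    -- comparison of rationals is decidable.
    decidable-stable (1ℚ ℚ.≤? _) heavy
    where
    k = length xs ∸ 2 * c
    heavy : ¬ ¬ (1ℚ ℚ.≤ potential c₀ r (length xs C 2 ∸ c * (c ∸ 1)) (specs N c k) G)
    heavy with pairUp c k xs (sym (ℕ.m+[n∸m]≡n 2c≤m))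
    ... | qs , vs , refl , refl = optimal-exists qs vs λ ps ws perm len opt →
      let |ws| : length ws ≡ k
          |ws| = trans (sym (ℕ.m+n∸m≡n (2 * length ps) (length ws)))
            (cong₂ (λ a b → a ∸ 2 * b) (trans (sym (length-flat ps ws)) (↭.↭-length perm)) len)
      in ℚ.≤-trans
        (ℚ.≤-reflexive (cong (weight r) (sym
          (subst (λ l → status c₀ (length xs C 2 ∸ l * (l ∸ 1)) (spec 2≤m clique ps ws) G ≡ just 0) len
            (spec-complete 2≤m clique {ps} {ws} perm opt)))))
        (term≤∑ (λ σ → weight-nonNeg 0≤r (status c₀ _ σ G))
          (subst₂ (λ a b → spec 2≤m clique ps ws ∈ specs N a b) len |ws|
            (spec-∈ 2≤m clique {ps} {ws} perm opt)))

potential-[] : ∀ {c₀ r N m c} E → 0ℚ ℚ.≤ r → 2 * c ≤ m →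
  potential c₀ r E (specs N c (m ∸ 2 * c)) [] ℚ.≤ r ^ E ℚ.* ι (2 * N) ^ (m ∸ c)
potential-[] {r = r} {N} {m} {c} E 0≤r 2c≤m = begin
  ∑ S (λ _ → r ^ E)                   ≡⟨ ∑-const S (r ^ E) ⟩
  ι (length S) ℚ.* r ^ E              ≡⟨ ℚ.*-comm (ι (length S)) (r ^ E) ⟩
  r ^ E ℚ.* ι (length S)              ≤⟨ *-monoˡ (^-nonNeg 0≤r E) (ι-mono-≤ (length-specs N c (m ∸ 2 * c))) ⟩
  r ^ E ℚ.* ι ((2 * N) ℕ.^ (c + (m ∸ 2 * c)))
    ≡⟨ cong (λ k → r ^ E ℚ.* ι ((2 * N) ℕ.^ k)) exponent ⟩
  r ^ E ℚ.* ι ((2 * N) ℕ.^ (m ∸ c))   ≡⟨ cong (r ^ E ℚ.*_) (ι-^ (2 * N) (m ∸ c)) ⟩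
  r ^ E ℚ.* ι (2 * N) ^ (m ∸ c)       ∎
  where
  S = specs N c (m ∸ 2 * c)
  exponent : c + (m ∸ 2 * c) ≡ m ∸ c
  -- Each of the `c` matching edges replaces two vertex choices by one.
  exponent = trans (sym (ℕ.+-∸-assoc c 2c≤m))
    (trans (cong (c + m ∸_) (cong (c +_) (ℕ.+-identityʳ c))) (ℕ.[m+n]∸[m+o]≡n∸o c m c))
  open ℚ.≤-Reasoning

-- Painter's averaging argument.

module _ {m n N c d : ℕ} {r s : ℚ} (2≤m : 2 ≤ m) (2≤n : 2 ≤ n)
  (2c≤m : 2 * c ≤ m) (2d≤n : 2 * d ≤ n)
  (0≤r : 0ℚ ℚ.≤ r) (0≤s : 0ℚ ℚ.≤ s) (r+s≡1 : r ℚ.+ s ≡ 1ℚ) where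

  private
    E F : ℕ
    E = m C 2 ∸ c * (c ∸ 1)
    F = n C 2 ∸ d * (d ∸ 1)

    Φʳ Φᵇ : Position → ℚ
    Φʳ = potential red  r E (specs N c (m ∸ 2 * c))
    Φᵇ = potential blue s F (specs N d (n ∸ 2 * d))

  -- Induction on Builder's strategy. If both colourings of the next edge lead to potential at least
  -- 1, so does their average with weights `r` and `s`, which the current potential dominates.
  forces⇒1≤potential : ∀ {k G} → Simple G → k + length G ≤ N → BuilderForces m n k G →
    1ℚ ℚ.≤ Φʳ G ℚ.+ Φᵇ G
  forces⇒1≤potential {k} {G} simple le (done (inj₁ cl)) = begin
    1ℚ                 ≤⟨ clique⇒1≤potential simple (ℕ.m+n≤o⇒n≤o k le) {c = c} 0≤r 2≤m 2c≤m cl ⟩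
    Φʳ G               ≡⟨ ℚ.+-identityʳ (Φʳ G) ⟨
    Φʳ G ℚ.+ 0ℚ        ≤⟨ ℚ.+-monoʳ-≤ (Φʳ G) (∑-nonNeg (specs N d (n ∸ 2 * d))
                          λ σ → weight-nonNeg 0≤s (status blue F σ G)) ⟩
    Φʳ G ℚ.+ Φᵇ G      ∎
    where open ℚ.≤-Reasoning
  forces⇒1≤potential {k} {G} simple le (done (inj₂ cl)) = begin
    1ℚ                 ≤⟨ clique⇒1≤potential simple (ℕ.m+n≤o⇒n≤o k le) {c = d} 0≤s 2≤n 2d≤n cl ⟩
    Φᵇ G               ≡⟨ ℚ.+-identityˡ (Φᵇ G) ⟨
    0ℚ ℚ.+ Φᵇ G        ≤⟨ ℚ.+-monoˡ-≤ (Φᵇ G) (∑-nonNeg (specs N c (m ∸ 2 * c))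
                          λ σ → weight-nonNeg 0≤r (status red E σ G)) ⟩
    Φʳ G ℚ.+ Φᵇ G      ∎
    where open ℚ.≤-Reasoning
  forces⇒1≤potential {suc k} {G} simple le (turn u v u≢v ¬adj forces) = begin
    1ℚ                                   ≡⟨ r+s≡1 ⟨
    r ℚ.+ s                              ≡⟨ cong₂ ℚ._+_ (ℚ.*-identityʳ r) (ℚ.*-identityʳ s) ⟨
    r ℚ.* 1ℚ ℚ.+ s ℚ.* 1ℚ                ≤⟨ ℚ.+-mono-≤ (*-monoˡ 0≤r (next red)) (*-monoˡ 0≤s (next blue)) ⟩
    r ℚ.* (Φʳ R ℚ.+ Φᵇ R) ℚ.+ s ℚ.* (Φʳ B ℚ.+ Φᵇ B)
                                         ≡⟨ rearrange r s (Φʳ R) (Φᵇ R) (Φʳ B) (Φᵇ B) ⟩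
    -- For the blue potential a hit has probability `s` and a miss `r`, so its two terms are
    -- exchanged to fit `potential-step`.
    (r ℚ.* Φʳ R ℚ.+ s ℚ.* Φʳ B) ℚ.+ (s ℚ.* Φᵇ B ℚ.+ r ℚ.* Φᵇ R)
      ≤⟨ ℚ.+-mono-≤
           (potential-step (λ ()) r+s≡1 0≤s E (specs N c (m ∸ 2 * c)) G u v)
           (potential-step (λ ()) (trans (ℚ.+-comm s r) r+s≡1) 0≤r F (specs N d (n ∸ 2 * d)) G u v) ⟩
    Φʳ G ℚ.+ Φᵇ G                        ∎
    where
    open ℚ.≤-Reasoning
    R = (red  , u , v) ∷ G
    B = (blue , u , v) ∷ G
    next : ∀ c → 1ℚ ℚ.≤ Φʳ ((c , u , v) ∷ G) ℚ.+ Φᵇ ((c , u , v) ∷ G)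
    next c = forces⇒1≤potential (u≢v , ¬adj , simple)
      (ℕ.≤-trans (ℕ.≤-reflexive (ℕ.+-suc k (length G))) le) (forces c)
    rearrange : ∀ r s a b c d → r ℚ.* (a ℚ.+ b) ℚ.+ s ℚ.* (c ℚ.+ d) ≡
      (r ℚ.* a ℚ.+ s ℚ.* c) ℚ.+ (s ℚ.* d ℚ.+ r ℚ.* b)
    rearrange = solve 6 (λ r s a b c d → r :* (a :+ b) :+ s :* (c :+ d) :=
      (r :* a :+ s :* c) :+ (s :* d :+ r :* b)) refl
      where open ℚSolver.+-*-Solver

-- The two terms of the hypothesis, including one-vertex cliques.

bound : ℚ → (N m c : ℕ) → ℚ
bound r N m c = r ^ (m C 2 ∸ c * (c ∸ 1)) ℚ.* ι (2 * N) ^ (m ∸ c)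

bound-nonNeg : ∀ {r} N m c → 0ℚ ℚ.≤ r → 0ℚ ℚ.≤ bound r N m c
bound-nonNeg N m c 0≤r = *-nonNeg (^-nonNeg 0≤r (m C 2 ∸ c * (c ∸ 1))) (^-nonNeg (0≤ι (2 * N)) (m ∸ c))

-- A lone vertex has no first edge to charge, so this size is handled directly: `c` must be 0, the
-- power of `r` is trivial, and `2N` is at least 1.
1≤bound₁ : ∀ r {N c} → 1 ≤ N → 2 * c ≤ 1 → 1ℚ ℚ.≤ bound r N 1 c
1≤bound₁ r {N} {zero} 1≤N 2c≤1 = begin
  ι 1                            ≤⟨ ι-mono-≤ (ℕ.≤-trans 1≤N (ℕ.m≤m+n N _)) ⟩
  ι (2 * N)                      ≡⟨ ℚ.*-identityʳ (ι (2 * N)) ⟨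
  ι (2 * N) ^ 1                  ≡⟨ ℚ.*-identityˡ (ι (2 * N) ^ 1) ⟨
  1ℚ ℚ.* ι (2 * N) ^ 1           ∎
  where open ℚ.≤-Reasoning
1≤bound₁ r {c = suc c} 1≤N 2c≤1 = ⊥-elim (ℕ.<⇒≱
  (ℕ.≤-trans (s≤s (s≤s z≤n)) (ℕ.≤-reflexive (sym (ℕ.*-suc 2 c)))) 2c≤1)

forces⇒1≤bounds : ∀ {m n N k c d r s} → 1 ≤ m → 1 ≤ n → 1 ≤ N → 2 * c ≤ m → 2 * d ≤ n →
  0ℚ ℚ.≤ r → 0ℚ ℚ.≤ s → r ℚ.+ s ≡ 1ℚ → k ≤ N → BuilderForces m n k [] →
  1ℚ ℚ.≤ bound r N m c ℚ.+ bound s N n d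
forces⇒1≤bounds {1} {n} {N} {c = c} {d} {r} {s} _ _ 1≤N 2c≤1 _ 0≤r 0≤s _ _ _ =
  ℚ.+-mono-≤ (1≤bound₁ r {c = c} 1≤N 2c≤1) (bound-nonNeg N n d 0≤s)
forces⇒1≤bounds {m} {1} {N} {c = c} {d} {r} {s} _ _ 1≤N _ 2d≤1 0≤r 0≤s _ _ _ =
  ℚ.+-mono-≤ (bound-nonNeg N m c 0≤r) (1≤bound₁ s {c = d} 1≤N 2d≤1)
forces⇒1≤bounds {m@(suc (suc _))} {n@(suc (suc _))} {N} {k} {c} {d} _ _ _ 2c≤m 2d≤n
  0≤r 0≤s r+s≡1 k≤N forces =
  ℚ.≤-trans
    (forces⇒1≤potential {c = c} {d} (s≤s (s≤s z≤n)) (s≤s (s≤s z≤n)) 2c≤m 2d≤n 0≤r 0≤s r+s≡1 tt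
      (subst (_≤ N) (sym (ℕ.+-identityʳ k)) k≤N) forces)
    (ℚ.+-mono-≤ (potential-[] {red} {N = N} {c = c} (m C 2 ∸ c * (c ∸ 1)) 0≤r 2c≤m)
      (potential-[] {blue} {N = N} {c = d} (n C 2 ∸ d * (d ∸ 1)) 0≤s 2d≤n))

-- From a real probability to a rational approximation.

seq-^ : ∀ x k i → seq (x ^ℝ k) i ≡ seq x i ^ k
seq-^ x zero    i = refl
seq-^ x (suc k) i = cong (seq x i ℚ.*_) (seq-^ x k i)

0<¼ : 0ℚ ℚ.< ½ ℚ.* ½
0<¼ = ℚ.positive⁻¹ (½ ℚ.* ½)

theorem1 : (m n N : ℕ) → 1 ≤ m → 1 ≤ n → 1 ≤ N →
    (∃[ p ] ∃[ c ] ∃[ d ]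
      (fromℕ 0 <ℝ p × p <ℝ fromℕ 1 × 2 * c ≤ m × 2 * d ≤ n ×
       p ^ℝ (m C 2 ∸ c * (c ∸ 1)) *ℝ fromℕ (2 * N) ^ℝ (m ∸ c)
         +ℝ (fromℕ 1 -ℝ p) ^ℝ (n C 2 ∸ d * (d ∸ 1)) *ℝ fromℕ (2 * N) ^ℝ (n ∸ d)
         ≤ℝ fromℚ ½)) →
    N < r̃ m n
theorem1 m n N 1≤m 1≤n 1≤N
  (p , c , d , (ε , 0<ε , M₀ , above) , (δ , 0<δ , M₁ , below) , 2c≤m , 2d≤n , small)
  -- A tolerance of 1/4 suffices: 1/2 + 1/4 is still below the value 1 that a win for Builder would
  -- force.
  with small (½ ℚ.* ½) 0<¼
... | M₂ , close = ℕ.≰⇒> λ r̃≤N → ℚ.<-irrefl refl (ℚ.<-≤-trans sum<1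
  (forces⇒1≤bounds {c = c} {d} 1≤m 1≤n 1≤N 2c≤m 2d≤n 0≤r 0≤s r+s≡1 r̃≤N
    (proj₁ (r̃-isOnlineRamseyNumber m n))))
  where
  i : ℕ
  -- An index past all three thresholds, so that the approximation lies between 0 and 1 and
  -- satisfies the hypothesis up to the tolerance.
  i = M₀ ⊔ (M₁ ⊔ M₂)
  r s : ℚ
  r = seq p i
  s = 1ℚ ℚ.- r
  0≤r : 0ℚ ℚ.≤ r
  0≤r = ℚ.≤-trans (ℚ.<⇒≤ 0<ε)
    (subst (ℚ._≤ r) (ℚ.+-identityˡ ε) (above i (ℕ.m≤m⊔n M₀ _)))
  r≤1 : r ℚ.≤ 1ℚ
  r≤1 = begin
    r          ≡⟨ ℚ.+-identityʳ r ⟨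
    r ℚ.+ 0ℚ   ≤⟨ ℚ.+-monoʳ-≤ r (ℚ.<⇒≤ 0<δ) ⟩
    r ℚ.+ δ    ≤⟨ below i (ℕ.≤-trans (ℕ.m≤m⊔n M₁ M₂) (ℕ.m≤n⊔m M₀ _)) ⟩
    1ℚ         ∎
    where open ℚ.≤-Reasoning
  0≤s : 0ℚ ℚ.≤ s
  0≤s = subst (ℚ._≤ s) (ℚ.+-inverseʳ r) (ℚ.+-monoˡ-≤ (ℚ.- r) r≤1)
  r+s≡1 : r ℚ.+ s ≡ 1ℚ
  r+s≡1 = solve 2 (λ r e → r :+ (e :- r) := e) refl r 1ℚ
    where open ℚSolver.+-*-Solver
  term : ∀ x k l → seq (x ^ℝ k *ℝ fromℕ (2 * N) ^ℝ l) i ≡ seq x i ^ k ℚ.* ι (2 * N) ^ l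
  term x k l = cong₂ ℚ._*_ (seq-^ x k i) (seq-^ (fromℕ (2 * N)) l i)
  sum<1 : bound r N m c ℚ.+ bound s N n d ℚ.< 1ℚ
  sum<1 = begin-strict
    bound r N m c ℚ.+ bound s N n d
      ≡⟨ cong₂ ℚ._+_ (term p (m C 2 ∸ c * (c ∸ 1)) (m ∸ c))
          (term (fromℕ 1 -ℝ p) (n C 2 ∸ d * (d ∸ 1)) (n ∸ d)) ⟨
    _
      ≤⟨ close i (ℕ.≤-trans (ℕ.m≤n⊔m M₁ M₂) (ℕ.m≤n⊔m M₀ _)) ⟩
    ½ ℚ.+ ½ ℚ.* ½
      <⟨ from-yes (½ ℚ.+ ½ ℚ.* ½ ℚ.<? 1ℚ) ⟩
    1ℚ ∎
    where open ℚ.≤-Reasoning
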